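{- Let $\mathbb F_q$ be a finite field of odd characteristic and fix a nonsquare $\sigma\in\mathbb F_q^{\ast}$. Of all the $q^3(q^2-1)$ distinct quadratic rational expressions over $\mathbb F_q$, precisely $q^2(q^2-1)(q+1)/2$ are equivalent (over $\mathbb F_q$) to $x^2$, and precisely $q^2(q^2-1)(q-1)/2$ are equivalent (over $\mathbb F_q$) to $(x^2+\sigma)/(2x)$.
   Context: A rational expression $R(x)=g(x)/h(x)\in K(x)$ with $g,h$ coprime has degree $\max(\deg g,\deg h)$; quadratic means degree $2$. The group $G(K)=\mathrm{PGL}_2(K)\times\mathrm{PGL}_2(K)$, with $\mathrm{PGL}_2(K)$ identified with the group of degree-one rational expressions (Möbius transformations) under composition, acts on $K(x)$ by $(B,A)\cdot R(x)=B(R(A^{ -1}(x)))$. Two rational expressions are called equivalent (over $K$) if they lie in the same $G(K)$-orbit. -}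

module Defs where

open import Level using (Level; _⊔_)
open import Data.Nat as ℕ using (ℕ; zero; suc)
open import Data.Product using (Σ; ∃; _×_; _,_)
open import Data.Sum using (_⊎_)
open import Data.List using (List; []; _∷_; length)
open import Data.List.Relation.Unary.Any using (Any; here; there)
open import Data.List.Relation.Unary.All using (All)
open import Data.List.Relation.Unary.AllPairs using (AllPairs)
open import Relation.Nullary using (¬_)
open import Relation.Binary.PropositionalEquality using (_≡_)
open import Algebra.Bundles using (CommutativeRing)

IsField : ∀ {c ℓ} → CommutativeRing c ℓ → Set (c ⊔ ℓ)
IsField R = ¬ (1# ≈ 0#) × (∀ x → ¬ (x ≈ 0#) → ∃ λ y → x * y ≈ 1#)
  where open CommutativeRing R

HasCardinality : ∀ {c ℓ} → CommutativeRing c ℓ → ℕ → Set (c ⊔ ℓ)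
HasCardinality R q =
  Σ (List Carrier) λ es →
    length es ≡ q × AllPairs (λ a b → ¬ (a ≈ b)) es × (∀ x → Any (x ≈_) es)
  where open CommutativeRing R

OddCharacteristic : ∀ {c ℓ} → CommutativeRing c ℓ → Set ℓ
OddCharacteristic R = ¬ (1# + 1# ≈ 0#)
  where open CommutativeRing R

IsNonsquare : ∀ {c ℓ} (R : CommutativeRing c ℓ) → CommutativeRing.Carrier R → Set (c ⊔ ℓ)
IsNonsquare R σ = ¬ (σ ≈ 0#) × (∀ y → ¬ (y * y ≈ σ))
  where open CommutativeRing R

module Over {c ℓ} (K : CommutativeRing c ℓ) where
  open CommutativeRing K

  -- Polynomials in K[x]: coefficient lists, constant term first
  -- (trailing zeros allowed; polynomials are compared coefficientwise).
  Poly : Set c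
  Poly = List Carrier

  coeff : Poly → ℕ → Carrier
  coeff []       _       = 0#
  coeff (a ∷ p) zero    = a
  coeff (a ∷ p) (suc k) = coeff p k

  _≈P_ : Poly → Poly → Set ℓ
  p ≈P r = ∀ k → coeff p k ≈ coeff r k

  _+P_ : Poly → Poly → Poly
  []      +P r       = r
  (a ∷ p) +P []      = a ∷ p
  (a ∷ p) +P (b ∷ r) = (a + b) ∷ (p +P r)

  _·P_ : Carrier → Poly → Poly
  a ·P []      = []
  a ·P (b ∷ p) = (a * b) ∷ (a ·P p)

  _*P_ : Poly → Poly → Poly
  []      *P r = []
  (a ∷ p) *P r = (a ·P r) +P (0# ∷ (p *P r))

  _^P_ : Poly → ℕ → Poly
  p ^P zero  = 1# ∷ []
  p ^P suc n = p *P (p ^P n)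

  _∣P_ : Poly → Poly → Set (c ⊔ ℓ)
  d ∣P p = Σ Poly λ e → (d *P e) ≈P p

  IsConstant : Poly → Set ℓ
  IsConstant d = ∀ k → coeff d (suc k) ≈ 0#

  Coprime : Poly → Poly → Set (c ⊔ ℓ)
  Coprime g h = ∀ d → d ∣P g → d ∣P h → IsConstant d

  DegLe : Poly → ℕ → Set ℓ
  DegLe p n = ∀ k → coeff p (suc n ℕ.+ k) ≈ 0#

  NonZeroP : Poly → Set (c ⊔ ℓ)
  NonZeroP p = Any (λ a → ¬ (a ≈ 0#)) p

  record RatExpr : Set (c ⊔ ℓ) where
    constructor _/_[_]
    field
      num : Poly
      den : Poly
      den≠0 : NonZeroP den
  open RatExpr public

  _≈F_ : Poly × Poly → Poly × Poly → Set ℓ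
  (g , h) ≈F (g' , h') = (g *P h') ≈P (g' *P h)

  _≈R_ : RatExpr → RatExpr → Set ℓ
  R ≈R S = (num R , den R) ≈F (num S , den S)

  -- Degree of g/h (g, h coprime) is max(deg g, deg h); "R is quadratic"
  -- means R = g/h in K(x) with g, h coprime and max(deg g, deg h) = 2.
  IsQuadratic : RatExpr → Set (c ⊔ ℓ)
  IsQuadratic R =
    Σ RatExpr λ S → (S ≈R R) × Coprime (num S) (den S)
      × DegLe (num S) 2 × DegLe (den S) 2
      × (¬ (coeff (num S) 2 ≈ 0#) ⊎ ¬ (coeff (den S) 2 ≈ 0#))

  record Mobius : Set (c ⊔ ℓ) where
    constructor mob
    field
      ma mb mc md : Carrier
      det≠0 : ¬ (ma * md - mb * mc ≈ 0#)
  open Mobius public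

  -- homogenised substitution: for p = Σ p_i x^i with length p ≤ n + 1,
  --   hom A n p = Σ_i p_i (a x + b)^i (c x + d)^(n - i)
  --             = (c x + d)^n · p((a x + b)/(c x + d)).
  hom : Mobius → ℕ → Poly → Poly
  hom A n []      = []
  hom A n (a ∷ p) = (a ·P ((md A ∷ mc A ∷ []) ^P n))
                    +P ((mb A ∷ ma A ∷ []) *P hom A (ℕ.pred n) p)

  -- R ∘ A  (substitute x := A(x)) as a formal fraction: numerator and
  -- denominator both multiplied by (c x + d)^n, n = max(length g, length h).
  _∘M_ : RatExpr → Mobius → Poly × Poly
  R ∘M A = hom A n (num R) , hom A n (den R)
    where n = length (num R) ℕ.⊔ length (den R)

  _M∘_ : Mobius → RatExpr → Poly × Poly
  B M∘ R = (ma B ·P num R) +P (mb B ·P den R) , (mc B ·P num R) +P (md B ·P den R)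

  -- R and S are equivalent: S = B ∘ R ∘ A⁻¹ for some (B, A) ∈ G(K),
  -- i.e. S ∘ A = B ∘ R in K(x).
  Equivalent : RatExpr → RatExpr → Set (c ⊔ ℓ)
  Equivalent R S = Σ Mobius λ A → Σ Mobius λ B → (S ∘M A) ≈F (B M∘ R)

  CountIs : ℕ → (RatExpr → Set (c ⊔ ℓ)) → Set (c ⊔ ℓ)
  CountIs N P =
    Σ (List RatExpr) λ L →
      length L ≡ N × All P L × AllPairs (λ R S → ¬ (R ≈R S)) L
      × (∀ R → P R → Any (R ≈R_) L)

  xSquared : ¬ (1# ≈ 0#) → RatExpr
  xSquared 1≉0 = (0# ∷ 0# ∷ 1# ∷ []) / (1# ∷ []) [ here 1≉0 ]

  xSqPlusσOver2x : Carrier → ¬ (1# + 1# ≈ 0#) → RatExpr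
  xSqPlusσOver2x σ 2≉0 =
    (σ ∷ 0# ∷ 1# ∷ []) / (0# ∷ (1# + 1#) ∷ []) [ there (here 2≉0) ]

{-# OPTIONS --safe #-}
module Submission where

-- The discriminant of the Wronskian W = g' h − g h' of g and h of degree at most 2 is four times
-- their resultant. Postcomposition with a Möbius map only rescales W, and a quadratic R = g/h is
-- B ∘ C for a unique B ∈ PGL₂(K) and a unique core C determined by the line of W: either x² + u x,
-- or x − v + D/(x + v) with D ≠ 0, of discriminant 1 and D up to squares. Precomposition with A
-- multiplies the discriminant by a power of det(A)², so its square class is an invariant of R; it is
-- trivial for x² and the class of σ for (x² + σ)/(2x). Conversely y + s²/y and y + σ s²/y are
-- explicitly equivalent to these two. As there are h = (q − 1)/2 nonzero squares, there are
-- q + q (q − 1) cores in all, q + q h of them with discriminant a square and q h with discriminant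
-- in σ K*²; each number is to be multiplied by the order q³ − q of PGL₂(K).

open import Defs
open import Level using (Level; _⊔_)
open import Algebra.Bundles using (CommutativeRing)
import Algebra.Solver.Ring
open import Algebra.Solver.Ring.AlmostCommutativeRing
  using (fromCommutativeRing; _-Raw-AlmostCommutative⟶_; Induced-equivalence)
open import Data.Fin using (Fin; zero; suc; toℕ)
import Data.Fin.Properties as Fin
open import Data.Integer as ℤ using (ℤ; +_; -[1+_])
import Data.Integer.Properties as ℤ
open import Data.List using (List; []; _∷_; length; map; _++_; cartesianProduct; lookup)
open import Data.List.Properties using (length-map; length-++)
open import Data.List.Membership.Propositional.Properties using (∈-lookup)
import Data.List.Membership.Setoid as Membership
import Data.List.Membership.Setoid.Properties as Membership
open import Data.List.Relation.Unary.All as All using (All; []; _∷_)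
import Data.List.Relation.Unary.All.Properties as All
open import Data.List.Relation.Unary.AllPairs as AllPairs using ([]; _∷_)
import Data.List.Relation.Unary.AllPairs.Properties as AllPairs
open import Data.List.Relation.Unary.Any as Any using (Any; here; there; index)
import Data.List.Relation.Unary.Any.Properties as Any
open import Data.List.Relation.Unary.Enumerates.Setoid using (IsEnumeration)
import Data.List.Relation.Unary.Enumerates.Setoid.Properties as Enumeration
open import Data.List.Relation.Unary.Unique.Setoid using (Unique)
import Data.List.Relation.Unary.Unique.Setoid.Properties as Unique
open import Data.Maybe using (Maybe; just; nothing)
open import Data.Nat as ℕ using (ℕ; zero; suc; _≤_)
open import Data.Nat.DivMod using (m*n/n≡m)
import Data.Nat.Properties as ℕ
open import Data.Nat.Solver using (module +-*-Solver)
open import Data.Product using (Σ; ∃; _×_; _,_; proj₁; proj₂)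
open import Data.Product.Relation.Binary.Pointwise.NonDependent using (_×ₛ_)
open import Data.Sum using (_⊎_; inj₁; inj₂)
open import Data.Sum.Relation.Binary.Pointwise using (_⊎ₛ_; inj₁; inj₂)
open import Data.Unit.Polymorphic using (⊤; tt)
open import Function using (_∘_)
open import Relation.Binary.Bundles using (Setoid)
import Relation.Binary.Construct.On as On
open import Relation.Binary.Definitions using (Decidable; _Respects_; tri<; tri≈; tri>)
open import Relation.Binary.PropositionalEquality as ≡ using (_≡_)
import Relation.Binary.Reasoning.Setoid as SetoidReasoning
open import Relation.Binary.Structures using (IsEquivalence)
open import Relation.Nullary using (¬_; yes; no; contradiction)
open import Relation.Nullary.Decidable using (¬?; _×-dec_)
import Relation.Unary as Unary

-- Postcomposition replaces (g, h) by another basis, up to scaling, of the plane that g and h span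
-- among the polynomials of degree at most 2, and the Wronskian carries the Plücker coordinates of
-- this plane. A core is the reduced echelon basis of the plane for the order x², x, 1, which is why
-- it is unique: the pivots are x² and 1 or x² and x, while the plane of x and 1 is excluded by the
-- degree. For the pivots x² and x, the number D is the value of the numerator at the root -v of the
-- denominator, so that D ≠ 0 expresses coprimality. Orbits and stabilisers under precomposition are
-- never computed: the square class of D decides equivalence, and the lists are indexed by pairs of
-- a normalised matrix and a core. Equality in K(x) is cross-multiplication of fractions that may be
-- unreduced. Inverse matrices are therefore replaced by adjugates, and the scalars and common
-- factors left behind are carried along until they cancel. In the comparison of discriminants these
-- scalars enter only as squares, so the square class survives.

-- Cardinalities of finite setoids.

module FiniteSetoids where
  open Setoid using (Carrier)
  private variable
    a b ℓ ℓ₁ ℓ₂ : Level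
    m n : ℕ

  length-cartesianProduct : ∀ {A : Set a} {B : Set b} (xs : List A) (ys : List B) →
    length (cartesianProduct xs ys) ≡ length xs ℕ.* length ys
  length-cartesianProduct []       ys = ≡.refl
  length-cartesianProduct (x ∷ xs) ys = ≡.trans (length-++ (map (x ,_) ys))
    (≡.cong₂ ℕ._+_ (length-map (x ,_) ys) (length-cartesianProduct xs ys))

  Card : Setoid a ℓ → ℕ → Set (a ⊔ ℓ)
  Card S n = Σ (List (Carrier S)) λ xs → length xs ≡ n × Unique S xs × IsEnumeration S xs

  module _ (S : Setoid a ℓ) where
    open Setoid S hiding (Carrier)

    lookup-injective : ∀ {xs} → Unique S xs → ∀ i j → lookup xs i ≈ lookup xs j → i ≡ j
    lookup-injective (x∉ ∷ u) zero    zero    e = ≡.refl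
    lookup-injective (x∉ ∷ u) zero    (suc j) e = contradiction e (All.lookup x∉ (∈-lookup j))
    lookup-injective (x∉ ∷ u) (suc i) zero    e = contradiction (sym e) (All.lookup x∉ (∈-lookup i))
    lookup-injective (x∉ ∷ u) (suc i) (suc j) e = ≡.cong suc (lookup-injective u i j e)

    -- Pigeonhole principle: sending each entry to its index in the enumeration is injective.
    unique-length≤ : ∀ {ys} → Card S n → Unique S ys → length ys ≤ n
    unique-length≤ {ys = ys} (xs , ≡.refl , _ , _∈xs) u =
      Fin.injective⇒≤ {f = λ i → index (lookup ys i ∈xs)} λ {i} {j} e →
        lookup-injective u i j (Membership.index-injective S (lookup ys i ∈xs) (lookup ys j ∈xs) e)

    -- Positions transport the decidable equality and the linear order of ℕ to S. The first makes
    -- equality in K decidable, the second singles out one of x and -x.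
    position : Card S n → Carrier S → ℕ
    position (xs , _ , _ , _∈xs) x = toℕ (index (x ∈xs))

    position-injective : (S-n : Card S n) → ∀ {x y} → position S-n x ≡ position S-n y → x ≈ y
    position-injective (_ , _ , _ , _∈xs) {x} {y} e =
      Membership.index-injective S (x ∈xs) (y ∈xs) (Fin.toℕ-injective e)

    position-cong : (S-n : Card S n) → ∀ {x y} → x ≈ y → position S-n x ≡ position S-n y
    position-cong (_ , _ , u , _∈xs) {x} {y} x≈y = ≡.cong toℕ (lookup-injective u _ _
      (trans (sym (Any.lookup-index (x ∈xs))) (trans x≈y (Any.lookup-index (y ∈xs)))))

    decidable : Card S n → Decidable _≈_
    decidable S-n x y with position S-n x ℕ.≟ position S-n y
    ... | yes e = yes (position-injective S-n e)
    ... | no ¬e = no λ x≈y → ¬e (position-cong S-n x≈y)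

    module _ {P : Carrier S → Set ℓ₁} where

      subsetoid : Setoid (a ⊔ ℓ₁) ℓ
      subsetoid = On.setoid {B = ∃ P} S proj₁

      module _ (P? : Unary.Decidable P) where

        restrict : List (Carrier S) → List (∃ P)
        restrict [] = []
        restrict (x ∷ xs) with P? x
        ... | yes p = (x , p) ∷ restrict xs
        ... | no  _ = restrict xs

        restrict-All : ∀ {Q : Carrier S → Set ℓ₂} {xs} → All Q xs → All (Q ∘ proj₁) (restrict xs)
        restrict-All [] = []
        restrict-All {xs = x ∷ xs} (q ∷ qs) with P? x
        ... | yes _ = q ∷ restrict-All qs
        ... | no  _ = restrict-All qs

        restrict-unique : ∀ {xs} → Unique S xs → Unique subsetoid (restrict xs)
        restrict-unique [] = []
        restrict-unique {xs = x ∷ xs} (x∉ ∷ u) with P? x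
        ... | yes _ = restrict-All x∉ ∷ restrict-unique u
        ... | no  _ = restrict-unique u

        restrict-∈ : P Respects _≈_ → ∀ {xs} ((x , p) : ∃ P) → Any (x ≈_) xs →
                     Any (λ y → x ≈ proj₁ y) (restrict xs)
        restrict-∈ resp {y ∷ xs} (x , p) x∈ with P? y | x∈
        ... | yes _ | here x≈y = here x≈y
        ... | yes _ | there x∈xs = there (restrict-∈ resp (x , p) x∈xs)
        ... | no ¬p | here x≈y = contradiction (resp x≈y p) ¬p
        ... | no _  | there x∈xs = restrict-∈ resp (x , p) x∈xs

        -- The size is left existential: it is identified only afterwards, through bijections.
        card-subsetoid : P Respects _≈_ → Card S n → ∃ (Card subsetoid)
        card-subsetoid resp (xs , _ , u , _∈xs) =
          _ , restrict xs , ≡.refl , restrict-unique u , λ y → restrict-∈ resp y (proj₁ y ∈xs)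

  module _ (S : Setoid a ℓ₁) (T : Setoid b ℓ₂) where
    private
      module S = Setoid S
      module T = Setoid T

    card-⊎ : Card S m → Card T n → Card (S ⊎ₛ T) (m ℕ.+ n)
    card-⊎ (xs , ≡.refl , u , e) (ys , ≡.refl , v , f) =
      map inj₁ xs ++ map inj₂ ys ,
      ≡.trans (length-++ (map inj₁ xs)) (≡.cong₂ ℕ._+_ (length-map inj₁ xs) (length-map inj₂ ys)) ,
      Unique.++⁺ (S ⊎ₛ T)
        (Unique.map⁺ S (S ⊎ₛ T) (λ { (inj₁ x) → x }) u)
        (Unique.map⁺ T (S ⊎ₛ T) (λ { (inj₂ x) → x }) v)
        disjoint ,
      Enumeration.++⁺ S T e f
      where
      disjoint : ∀ {v} → ¬ (Membership._∈_ (S ⊎ₛ T) v (map inj₁ xs) × Membership._∈_ (S ⊎ₛ T) v (map inj₂ ys))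
      disjoint (p , q) with Membership.∈-map⁻ S (S ⊎ₛ T) p | Membership.∈-map⁻ T (S ⊎ₛ T) q
      ... | _ , _ , inj₁ _ | _ , _ , ()

    card-× : Card S m → Card T n → Card (S ×ₛ T) (m ℕ.* n)
    card-× (xs , ≡.refl , u , e) (ys , ≡.refl , v , f) =
      cartesianProduct xs ys , length-cartesianProduct xs ys ,
      Unique.cartesianProduct⁺ S T u v , Enumeration.cartesianProduct⁺ S T e f

    module _ (f : S.Carrier → T.Carrier) (f-inj : ∀ {x y} → f x T.≈ f y → x S.≈ y) where

      card-≤ : Card S m → Card T n → m ≤ n
      card-≤ (xs , ≡.refl , u , _) T-n =
        ≡.subst (_≤ _) (length-map f xs) (unique-length≤ T T-n (Unique.map⁺ S T f-inj u))

  module _ (S : Setoid a ℓ₁) (T : Setoid b ℓ₂) where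
    private
      module S = Setoid S
      module T = Setoid T

    -- The section chosen by `f-surj` is injective because f respects equality, so there are
    -- injections both ways.
    card-bijective : (f : S.Carrier → T.Carrier) →
                     (∀ {x y} → x S.≈ y → f x T.≈ f y) →
                     (∀ {x y} → f x T.≈ f y → x S.≈ y) →
                     (∀ y → ∃ λ x → f x T.≈ y) →
                     Card S m → Card T n → m ≡ n
    card-bijective f f-cong f-inj f-surj S-m T-n = ℕ.≤-antisym
      (card-≤ S T f f-inj S-m T-n)
      (card-≤ T S (proj₁ ∘ f-surj)
        (λ {x} {y} e → T.trans (T.sym (proj₂ (f-surj x))) (T.trans (f-cong e) (proj₂ (f-surj y)))) T-n S-m)

-- A ring solver with integer coefficients.

module IntegerSolver {κ ℓ} (R : CommutativeRing κ ℓ) where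
  open CommutativeRing R
  open import Algebra.Properties.Ring ring
  open import Algebra.Properties.AbelianGroup +-abelianGroup using (⁻¹-∙-comm)
  open import Algebra.Properties.Semiring.Mult.TCOptimised semiring renaming (_×_ to _ᴺ×_)
  open import Relation.Binary.Reasoning.Setoid setoid

  -- Reduces a deduction to a ring identity: z = w follows from x = y once the difference of the new
  -- sides is that of the old ones. With x = y a linear combination of known equations, the second
  -- argument is a certificate that the solver checks.
  by : ∀ {x y z w} → x ≈ y → z - w ≈ x - y → z ≈ w
  by {x} {y} {z} {w} x≈y e =
    x∙y⁻¹≈ε⇒x≈y z w (trans e (trans (+-congʳ x≈y) (-‿inverseʳ y)))

  -- Taking coefficients in ℤ lets the solver decide by computation that terms cancel, in any
  -- commutative ring; it serves both K and K[x].
  fromℤ : ℤ → Carrier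
  fromℤ (+ n)    = n ᴺ× 1#
  fromℤ -[1+ n ] = - (suc n ᴺ× 1#)

  cancel-one : ∀ x y → (1# + x) - (1# + y) ≈ x - y
  cancel-one x y = begin
    (1# + x) - (1# + y)       ≈⟨ +-cong (+-comm 1# x) (sym (⁻¹-∙-comm 1# y)) ⟩
    (x + 1#) + (- 1# - y)     ≈⟨ +-assoc x 1# _ ⟩
    x + (1# + (- 1# - y))     ≈⟨ +-congˡ (sym (+-assoc 1# (- 1#) (- y))) ⟩
    x + ((1# - 1#) - y)       ≈⟨ +-congˡ (trans (+-congʳ (-‿inverseʳ 1#)) (+-identityˡ _)) ⟩
    x - y                     ∎

  fromℤ-⊖ : ∀ m n → fromℤ (m ℤ.⊖ n) ≈ m ᴺ× 1# - n ᴺ× 1#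
  fromℤ-⊖ m zero = begin
    m ᴺ× 1#        ≈⟨ +-identityʳ _ ⟨
    m ᴺ× 1# + 0#   ≈⟨ +-congˡ -0#≈0# ⟨
    m ᴺ× 1# - 0#   ∎
  fromℤ-⊖ zero (suc n) = sym (+-identityˡ _)
  fromℤ-⊖ (suc m) (suc n) = begin
    fromℤ (suc m ℤ.⊖ suc n)        ≡⟨ ≡.cong fromℤ (ℤ.[1+m]⊖[1+n]≡m⊖n m n) ⟩
    fromℤ (m ℤ.⊖ n)                ≈⟨ fromℤ-⊖ m n ⟩
    m ᴺ× 1# - n ᴺ× 1#                ≈⟨ cancel-one _ _ ⟨
    (1# + m ᴺ× 1#) - (1# + n ᴺ× 1#)  ≈⟨ +-cong (1+× m 1#) (-‿cong (1+× n 1#)) ⟨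
    suc m ᴺ× 1# - suc n ᴺ× 1#        ∎

  fromℤ-+ : ∀ i j → fromℤ (i ℤ.+ j) ≈ fromℤ i + fromℤ j
  fromℤ-+ (+ m)    (+ n)    = ×-homo-+ 1# m n
  fromℤ-+ (+ m)    -[1+ n ] = fromℤ-⊖ m (suc n)
  fromℤ-+ -[1+ m ] (+ n)    = trans (fromℤ-⊖ n (suc m)) (+-comm _ _)
  fromℤ-+ -[1+ m ] -[1+ n ] = begin
    - (suc (suc (m ℕ.+ n)) ᴺ× 1#)          ≡⟨ ≡.cong (λ k → - (suc k ᴺ× 1#)) (ℕ.+-suc m n) ⟨
    - ((suc m ℕ.+ suc n) ᴺ× 1#)            ≈⟨ -‿cong (×-homo-+ 1# (suc m) (suc n)) ⟩
    - (suc m ᴺ× 1# + suc n ᴺ× 1#)           ≈⟨ ⁻¹-∙-comm _ _ ⟨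
    - (suc m ᴺ× 1#) - suc n ᴺ× 1#           ∎

  fromℤ-neg : ∀ i → fromℤ (ℤ.- i) ≈ - fromℤ i
  fromℤ-neg (+ zero)  = sym -0#≈0#
  fromℤ-neg (+ suc n) = refl
  fromℤ-neg -[1+ n ]  = sym (-‿involutive _)

  fromℤ-pos-* : ∀ m j → fromℤ (+ m ℤ.* j) ≈ m ᴺ× 1# * fromℤ j
  fromℤ-pos-* m (+ n) = begin
    fromℤ (+ m ℤ.* + n)  ≡⟨ ≡.cong fromℤ (ℤ.pos-* m n) ⟨
    (m ℕ.* n) ᴺ× 1#       ≈⟨ ×1-homo-* m n ⟩
    m ᴺ× 1# * n ᴺ× 1#      ∎
  fromℤ-pos-* m -[1+ n ] = begin
    fromℤ (+ m ℤ.* -[1+ n ])        ≡⟨ ≡.cong fromℤ (ℤ.neg-distribʳ-* (+ m) (+ suc n)) ⟨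
    fromℤ (ℤ.- (+ m ℤ.* + suc n))   ≈⟨ fromℤ-neg (+ m ℤ.* + suc n) ⟩
    - fromℤ (+ m ℤ.* + suc n)       ≈⟨ -‿cong (fromℤ-pos-* m (+ suc n)) ⟩
    - (m ᴺ× 1# * suc n ᴺ× 1#)         ≈⟨ -‿distribʳ-* _ _ ⟩
    m ᴺ× 1# * - (suc n ᴺ× 1#)         ∎

  fromℤ-* : ∀ i j → fromℤ (i ℤ.* j) ≈ fromℤ i * fromℤ j
  fromℤ-* (+ m)    j = fromℤ-pos-* m j
  fromℤ-* -[1+ m ] j = begin
    fromℤ (-[1+ m ] ℤ.* j)          ≡⟨ ≡.cong fromℤ (ℤ.neg-distribˡ-* (+ suc m) j) ⟨
    fromℤ (ℤ.- (+ suc m ℤ.* j))     ≈⟨ fromℤ-neg (+ suc m ℤ.* j) ⟩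
    - fromℤ (+ suc m ℤ.* j)         ≈⟨ -‿cong (fromℤ-pos-* (suc m) j) ⟩
    - (suc m ᴺ× 1# * fromℤ j)        ≈⟨ -‿distribˡ-* _ _ ⟩
    - (suc m ᴺ× 1#) * fromℤ j        ∎

  fromℤ-morphism : ℤ.+-*-rawRing -Raw-AlmostCommutative⟶ fromCommutativeRing R
  fromℤ-morphism = record
    { ⟦_⟧    = fromℤ
    ; +-homo = fromℤ-+
    ; *-homo = fromℤ-*
    ; -‿homo = fromℤ-neg
    ; 0-homo = refl
    ; 1-homo = refl
    }

  fromℤ-≟ : ∀ i j → Maybe (Induced-equivalence fromℤ-morphism i j)
  fromℤ-≟ i j with i ℤ.≟ j
  ... | yes i≡j = just (reflexive (≡.cong fromℤ i≡j))
  ... | no  _   = nothing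

  open Algebra.Solver.Ring ℤ.+-*-rawRing (fromCommutativeRing R) fromℤ-morphism fromℤ-≟ public
    using (solve; _:=_; _:+_; _:*_; _:-_; :-_; con; Polynomial)

  :0 :1 : ∀ {n} → Polynomial n
  :0 = con (+ 0)
  :1 = con (+ 1)

-- The commutative ring K[x] of coefficient lists.

module PolynomialRing {κ ℓ} (K : CommutativeRing κ ℓ) where
  open CommutativeRing K
  open import Algebra.Properties.Ring ring using (-0#≈0#)
  open Over K public

  infix  4 _≋_

  -- Wrapping _≈P_ in a record keeps both polynomials inferable from an equality proof.
  record _≋_ (p r : Poly) : Set ℓ where
    constructor coeffwise
    field at : p ≈P r
  open _≋_ public

  ≋-isEquivalence : IsEquivalence _≋_
  ≋-isEquivalence = record
    { refl  = coeffwise λ _ → refl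
    ; sym   = λ e → coeffwise λ k → sym (at e k)
    ; trans = λ e f → coeffwise λ k → trans (at e k) (at f k)
    }

  ≋-setoid : Setoid κ ℓ
  ≋-setoid = record { isEquivalence = ≋-isEquivalence }

  private
    module ≋ = IsEquivalence ≋-isEquivalence
    module ≋-Reasoning = SetoidReasoning ≋-setoid

  X·_ : Poly → Poly
  X· p = 0# ∷ p

  -P_ : Poly → Poly
  -P_ = map (-_)

  coeff-+ : ∀ p r k → coeff (p +P r) k ≈ coeff p k + coeff r k
  coeff-+ []      r       k       = sym (+-identityˡ _)
  coeff-+ (a ∷ p) []      k       = sym (+-identityʳ _)
  coeff-+ (a ∷ p) (b ∷ r) zero    = refl
  coeff-+ (a ∷ p) (b ∷ r) (suc k) = coeff-+ p r k

  coeff-· : ∀ a p k → coeff (a ·P p) k ≈ a * coeff p k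
  coeff-· a []      k       = sym (zeroʳ a)
  coeff-· a (b ∷ p) zero    = refl
  coeff-· a (b ∷ p) (suc k) = coeff-· a p k

  coeff-neg : ∀ p k → coeff (-P p) k ≈ - coeff p k
  coeff-neg []      k       = sym -0#≈0#
  coeff-neg (a ∷ p) zero    = refl
  coeff-neg (a ∷ p) (suc k) = coeff-neg p k

  ∷-cong : ∀ {a b p r} → a ≈ b → p ≋ r → (a ∷ p) ≋ (b ∷ r)
  ∷-cong a≈b p≋r = coeffwise λ { zero → a≈b ; (suc k) → at p≋r k }

  X·0 : X· [] ≋ []
  X·0 = coeffwise λ { zero → refl ; (suc k) → refl }

  +P-cong : ∀ {p p' r r'} → p ≋ p' → r ≋ r' → (p +P r) ≋ (p' +P r')
  +P-cong {p} {p'} {r} {r'} e f = coeffwise λ k →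
    trans (coeff-+ p r k) (trans (+-cong (at e k) (at f k)) (sym (coeff-+ p' r' k)))

  +P-congˡ : ∀ p {r s} → r ≋ s → (p +P r) ≋ (p +P s)
  +P-congˡ p {r} {s} e = +P-cong {p} {p} {r} {s} ≋.refl e

  ·P-cong : ∀ {a b p r} → a ≈ b → p ≋ r → (a ·P p) ≋ (b ·P r)
  ·P-cong {a} {b} {p} {r} e f = coeffwise λ k →
    trans (coeff-· a p k) (trans (*-cong e (at f k)) (sym (coeff-· b r k)))

  -P-cong : ∀ {p r} → p ≋ r → (-P p) ≋ (-P r)
  -P-cong {p} {r} e = coeffwise λ k →
    trans (coeff-neg p k) (trans (-‿cong (at e k)) (sym (coeff-neg r k)))

  +P-assoc : ∀ p r s → ((p +P r) +P s) ≋ (p +P (r +P s))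
  +P-assoc p r s = coeffwise λ k → begin
    coeff ((p +P r) +P s) k                ≈⟨ coeff-+ (p +P r) s k ⟩
    coeff (p +P r) k + coeff s k           ≈⟨ +-congʳ (coeff-+ p r k) ⟩
    coeff p k + coeff r k + coeff s k      ≈⟨ +-assoc _ _ _ ⟩
    coeff p k + (coeff r k + coeff s k)    ≈⟨ +-congˡ (coeff-+ r s k) ⟨
    coeff p k + coeff (r +P s) k           ≈⟨ coeff-+ p (r +P s) k ⟨
    coeff (p +P (r +P s)) k                ∎
    where open SetoidReasoning setoid

  +P-comm : ∀ p r → (p +P r) ≋ (r +P p)
  +P-comm p r = coeffwise λ k →
    trans (coeff-+ p r k) (trans (+-comm _ _) (sym (coeff-+ r p k)))

  +P-identityʳ : ∀ p → (p +P []) ≋ p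
  +P-identityʳ p = +P-comm p []

  -P-inverseʳ : ∀ p → (p +P (-P p)) ≋ []
  -P-inverseʳ p = coeffwise λ k →
    trans (coeff-+ p (-P p) k) (trans (+-congˡ (coeff-neg p k)) (-‿inverseʳ _))

  +P-interchange : ∀ p r s t → ((p +P r) +P (s +P t)) ≋ ((p +P s) +P (r +P t))
  +P-interchange p r s t = begin
    (p +P r) +P (s +P t)   ≈⟨ +P-assoc p r (s +P t) ⟩
    p +P (r +P (s +P t))   ≈⟨ +P-congˡ p (+P-assoc r s t) ⟨
    p +P ((r +P s) +P t)   ≈⟨ +P-congˡ p (+P-cong {r +P s} {s +P r} {t} {t} (+P-comm r s) ≋.refl) ⟩
    p +P ((s +P r) +P t)   ≈⟨ +P-congˡ p (+P-assoc s r t) ⟩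
    p +P (s +P (r +P t))   ≈⟨ +P-assoc p s (r +P t) ⟨
    (p +P s) +P (r +P t)   ∎
    where open ≋-Reasoning

  ·P-distribˡ : ∀ a p r → (a ·P (p +P r)) ≋ ((a ·P p) +P (a ·P r))
  ·P-distribˡ a p r = coeffwise λ k → begin
    coeff (a ·P (p +P r)) k                  ≈⟨ coeff-· a (p +P r) k ⟩
    a * coeff (p +P r) k                     ≈⟨ *-congˡ (coeff-+ p r k) ⟩
    a * (coeff p k + coeff r k)              ≈⟨ distribˡ a _ _ ⟩
    a * coeff p k + a * coeff r k            ≈⟨ +-cong (coeff-· a p k) (coeff-· a r k) ⟨
    coeff (a ·P p) k + coeff (a ·P r) k      ≈⟨ coeff-+ (a ·P p) (a ·P r) k ⟨
    coeff ((a ·P p) +P (a ·P r)) k           ∎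
    where open SetoidReasoning setoid

  ·P-distribʳ : ∀ a b p → ((a + b) ·P p) ≋ ((a ·P p) +P (b ·P p))
  ·P-distribʳ a b p = coeffwise λ k → begin
    coeff ((a + b) ·P p) k                   ≈⟨ coeff-· (a + b) p k ⟩
    (a + b) * coeff p k                      ≈⟨ distribʳ _ a b ⟩
    a * coeff p k + b * coeff p k            ≈⟨ +-cong (coeff-· a p k) (coeff-· b p k) ⟨
    coeff (a ·P p) k + coeff (b ·P p) k      ≈⟨ coeff-+ (a ·P p) (b ·P p) k ⟨
    coeff ((a ·P p) +P (b ·P p)) k           ∎
    where open SetoidReasoning setoid

  ·P-assoc : ∀ a b p → ((a * b) ·P p) ≋ (a ·P (b ·P p))
  ·P-assoc a b p = coeffwise λ k → begin
    coeff ((a * b) ·P p) k   ≈⟨ coeff-· (a * b) p k ⟩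
    a * b * coeff p k        ≈⟨ *-assoc a b _ ⟩
    a * (b * coeff p k)      ≈⟨ *-congˡ (coeff-· b p k) ⟨
    a * coeff (b ·P p) k     ≈⟨ coeff-· a (b ·P p) k ⟨
    coeff (a ·P (b ·P p)) k  ∎
    where open SetoidReasoning setoid

  1·P : ∀ p → (1# ·P p) ≋ p
  1·P p = coeffwise λ k → trans (coeff-· 1# p k) (*-identityˡ _)

  0·P : ∀ p → (0# ·P p) ≋ []
  0·P p = coeffwise λ k → trans (coeff-· 0# p k) (zeroˡ _)

  ·P-X· : ∀ a p → (a ·P (X· p)) ≋ (X· (a ·P p))
  ·P-X· a p = ∷-cong (zeroʳ a) ≋.refl

  X·-+ : ∀ p r → ((X· p) +P (X· r)) ≋ (X· (p +P r))
  X·-+ p r = ∷-cong (+-identityˡ 0#) ≋.refl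

  *P-zeroʳ : ∀ p → (p *P []) ≋ []
  *P-zeroʳ []      = ≋.refl
  *P-zeroʳ (a ∷ p) = ≋.trans (∷-cong refl (*P-zeroʳ p)) X·0

  *P-congˡ : ∀ p {r s} → r ≋ s → (p *P r) ≋ (p *P s)
  *P-congˡ []      e = ≋.refl
  *P-congˡ (a ∷ p) e = +P-cong (·P-cong refl e) (∷-cong refl (*P-congˡ p e))

  *P-distribʳ : ∀ r p s → ((p +P s) *P r) ≋ ((p *P r) +P (s *P r))
  *P-distribʳ r []      s       = ≋.refl
  *P-distribʳ r (a ∷ p) []      = ≋.sym (+P-identityʳ _)
  *P-distribʳ r (a ∷ p) (b ∷ s) = begin
    ((a + b) ·P r) +P (X· ((p +P s) *P r))
      ≈⟨ +P-cong (·P-distribʳ a b r) (∷-cong refl (*P-distribʳ r p s)) ⟩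
    ((a ·P r) +P (b ·P r)) +P (X· ((p *P r) +P (s *P r)))
      ≈⟨ +P-congˡ _ (X·-+ (p *P r) (s *P r)) ⟨
    ((a ·P r) +P (b ·P r)) +P ((X· (p *P r)) +P (X· (s *P r)))
      ≈⟨ +P-interchange (a ·P r) (b ·P r) (X· (p *P r)) (X· (s *P r)) ⟩
    ((a ·P r) +P (X· (p *P r))) +P ((b ·P r) +P (X· (s *P r)))
      ∎
    where open ≋-Reasoning

  *P-·P : ∀ a p r → ((a ·P p) *P r) ≋ (a ·P (p *P r))
  *P-·P a []      r = ≋.refl
  *P-·P a (b ∷ p) r = begin
    ((a * b) ·P r) +P (X· ((a ·P p) *P r))    ≈⟨ +P-cong (·P-assoc a b r) (∷-cong refl (*P-·P a p r)) ⟩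
    (a ·P (b ·P r)) +P (X· (a ·P (p *P r)))   ≈⟨ +P-congˡ _ (·P-X· a (p *P r)) ⟨
    (a ·P (b ·P r)) +P (a ·P (X· (p *P r)))   ≈⟨ ·P-distribˡ a (b ·P r) _ ⟨
    a ·P ((b ·P r) +P (X· (p *P r)))          ∎
    where open ≋-Reasoning

  X·-*P : ∀ p r → ((X· p) *P r) ≋ (X· (p *P r))
  X·-*P p r = +P-cong (0·P r) ≋.refl

  *P-assoc : ∀ p r s → ((p *P r) *P s) ≋ (p *P (r *P s))
  *P-assoc []      r s = ≋.refl
  *P-assoc (a ∷ p) r s = begin
    ((a ·P r) +P (X· (p *P r))) *P s           ≈⟨ *P-distribʳ s (a ·P r) _ ⟩
    ((a ·P r) *P s) +P ((X· (p *P r)) *P s)    ≈⟨ +P-cong (*P-·P a r s) (X·-*P (p *P r) s) ⟩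
    (a ·P (r *P s)) +P (X· ((p *P r) *P s))    ≈⟨ +P-congˡ _ (∷-cong refl (*P-assoc p r s)) ⟩
    (a ·P (r *P s)) +P (X· (p *P (r *P s)))    ∎
    where open ≋-Reasoning

  -- The product recurses on its left factor; this is the mirrored recursion on the right one, from
  -- which commutativity follows.
  *P-∷ : ∀ p b r → (p *P (b ∷ r)) ≋ ((b ·P p) +P (X· (p *P r)))
  *P-∷ []      b r = ≋.sym X·0
  *P-∷ (a ∷ p) b r = ∷-cong (+-congʳ (*-comm a b)) (begin
    (a ·P r) +P (p *P (b ∷ r))                 ≈⟨ +P-congˡ _ (*P-∷ p b r) ⟩
    (a ·P r) +P ((b ·P p) +P (X· (p *P r)))    ≈⟨ +P-assoc (a ·P r) _ _ ⟨
    ((a ·P r) +P (b ·P p)) +P (X· (p *P r))    ≈⟨ +P-cong (+P-comm (a ·P r) _) ≋.refl ⟩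
    ((b ·P p) +P (a ·P r)) +P (X· (p *P r))    ≈⟨ +P-assoc (b ·P p) _ _ ⟩
    (b ·P p) +P ((a ·P r) +P (X· (p *P r)))    ∎)
    where open ≋-Reasoning

  *P-comm : ∀ p r → (p *P r) ≋ (r *P p)
  *P-comm []      r = ≋.sym (*P-zeroʳ r)
  *P-comm (a ∷ p) r = begin
    (a ·P r) +P (X· (p *P r))   ≈⟨ +P-congˡ _ (∷-cong refl (*P-comm p r)) ⟩
    (a ·P r) +P (X· (r *P p))   ≈⟨ *P-∷ r a p ⟨
    r *P (a ∷ p)                ∎
    where open ≋-Reasoning

  *P-cong : ∀ {p p' r r'} → p ≋ p' → r ≋ r' → (p *P r) ≋ (p' *P r')
  *P-cong {p} {p'} {r} {r'} e f = begin
    p *P r    ≈⟨ *P-comm p r ⟩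
    r *P p    ≈⟨ *P-congˡ r e ⟩
    r *P p'   ≈⟨ *P-comm r p' ⟩
    p' *P r   ≈⟨ *P-congˡ p' f ⟩
    p' *P r'  ∎
    where open ≋-Reasoning

  ⟪_⟫ : Carrier → Poly
  ⟪ a ⟫ = a ∷ []

  ⟪⟫-* : ∀ a p → (⟪ a ⟫ *P p) ≋ (a ·P p)
  ⟪⟫-* a p = ≋.trans (+P-congˡ _ X·0) (+P-identityʳ _)

  *P-identityˡ : ∀ p → (⟪ 1# ⟫ *P p) ≋ p
  *P-identityˡ p = ≋.trans (⟪⟫-* 1# p) (1·P p)

  K[x] : CommutativeRing κ ℓ
  K[x] = record
    { Carrier = Poly ; _≈_ = _≋_ ; _+_ = _+P_ ; _*_ = _*P_ ; -_ = -P_ ; 0# = [] ; 1# = ⟪ 1# ⟫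
    ; isCommutativeRing = record
      { isRing = record
        { +-isAbelianGroup = record
          { isGroup = record
            { isMonoid = record
              { isSemigroup = record
                { isMagma = record { isEquivalence = ≋-isEquivalence ; ∙-cong = +P-cong }
                ; assoc = +P-assoc }
              ; identity = (λ _ → ≋.refl) , +P-identityʳ }
            ; inverse = (λ p → ≋.trans (+P-comm (-P p) p) (-P-inverseʳ p)) , -P-inverseʳ
            ; ⁻¹-cong = -P-cong }
          ; comm = +P-comm }
        ; *-cong = *P-cong
        ; *-assoc = *P-assoc
        ; *-identity = *P-identityˡ , λ p → ≋.trans (*P-comm p _) (*P-identityˡ p)
        ; distrib = (λ p r s → ≋.trans (*P-comm p _)
                      (≋.trans (*P-distribʳ p r s) (+P-cong (*P-comm r p) (*P-comm s p))))
                    , *P-distribʳ }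
      ; *-comm = *P-comm } }

-- Degrees and cancellation over a field.

module FieldPolynomials {κ ℓ} (K : CommutativeRing κ ℓ) (isField : IsField K)
                        (_≟_ : Decidable (CommutativeRing._≈_ K)) where
  open CommutativeRing K public
  open import Algebra.Properties.Ring ring public
    using (-0#≈0#; x∙y⁻¹≈ε⇒x≈y)
  open PolynomialRing K public
  open IntegerSolver K public
  module K[x] = CommutativeRing K[x]
  module S = IntegerSolver K[x]

  1≉0 : ¬ 1# ≈ 0#
  1≉0 = proj₁ isField

  *-cancel-0 : ∀ {x y} → ¬ x ≈ 0# → x * y ≈ 0# → y ≈ 0#
  *-cancel-0 {x} {y} x≉0 xy≈0 = let x⁻¹ , xx⁻¹≈1 = proj₂ isField x x≉0 in begin
    y              ≈⟨ *-identityˡ y ⟨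
    1# * y         ≈⟨ *-congʳ xx⁻¹≈1 ⟨
    x * x⁻¹ * y    ≈⟨ solve 3 (λ x i y → x :* i :* y := i :* (x :* y)) refl x x⁻¹ y ⟩
    x⁻¹ * (x * y)  ≈⟨ *-congˡ xy≈0 ⟩
    x⁻¹ * 0#       ≈⟨ zeroʳ x⁻¹ ⟩
    0#             ∎
    where open SetoidReasoning setoid

  *-≉0 : ∀ {x y} → ¬ x ≈ 0# → ¬ y ≈ 0# → ¬ x * y ≈ 0#
  *-≉0 x≉0 y≉0 xy≈0 = y≉0 (*-cancel-0 x≉0 xy≈0)

  *-cancelˡ : ∀ {z x y} → ¬ z ≈ 0# → z * x ≈ z * y → x ≈ y
  *-cancelˡ {z} {x} {y} z≉0 e = x∙y⁻¹≈ε⇒x≈y x y (*-cancel-0 z≉0 (begin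
    z * (x - y)    ≈⟨ solve 3 (λ z x y → z :* (x :- y) := z :* x :- z :* y) refl z x y ⟩
    z * x - z * y  ≈⟨ +-congʳ e ⟩
    z * y - z * y  ≈⟨ -‿inverseʳ _ ⟩
    0#             ∎))
    where open SetoidReasoning setoid

  HasDegree : Poly → ℕ → Set ℓ
  HasDegree p n = ¬ coeff p n ≈ 0# × DegLe p n

  -- Lists may end in zeros, so the degree has to be found by testing coefficients, which uses
  -- decidable equality.
  zero-or-degree : ∀ p → p ≋ [] ⊎ ∃ (HasDegree p)
  zero-or-degree []      = inj₁ K[x].refl
  zero-or-degree (a ∷ p) with zero-or-degree p | a ≟ 0#
  ... | inj₂ (n , top , le) | _       = inj₂ (suc n , top , le)
  ... | inj₁ p≋0            | yes a≈0 = inj₁ (K[x].trans (∷-cong a≈0 p≋0) X·0)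
  ... | inj₁ p≋0            | no a≉0  = inj₂ (0 , a≉0 , at p≋0)

  coeff-*-suc : ∀ a p r k → coeff ((a ∷ p) *P r) (suc k) ≈ a * coeff r (suc k) + coeff (p *P r) k
  coeff-*-suc a p r k = trans (coeff-+ (a ·P r) _ (suc k)) (+-congʳ (coeff-· a r (suc k)))

  -- The bounds m and n need not be attained, so the induction can drop the constant term of p and
  -- lower m by one.
  leading-coeff-* : ∀ p r {m n} → DegLe p m → DegLe r n →
                    coeff (p *P r) (m ℕ.+ n) ≈ coeff p m * coeff r n
  leading-coeff-* []      r p≤m r≤n = sym (zeroˡ _)
  leading-coeff-* (a ∷ p) r {zero} {n} p≤m r≤n = begin
    coeff ((a ·P r) +P (X· (p *P r))) n
      ≈⟨ coeff-+ (a ·P r) _ n ⟩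
    coeff (a ·P r) n + coeff (X· (p *P r)) n
      ≈⟨ +-cong (coeff-· a r n) (at (∷-cong refl (*P-cong p≋0 (K[x].refl {r}))) n) ⟩
    a * coeff r n + coeff (X· []) n
      ≈⟨ trans (+-congˡ (at X·0 n)) (+-identityʳ _) ⟩
    a * coeff r n
      ∎
    where
    open SetoidReasoning setoid
    p≋0 : p ≋ []
    p≋0 = coeffwise p≤m
  leading-coeff-* (a ∷ p) r {suc m} {n} p≤m r≤n = begin
    coeff ((a ∷ p) *P r) (suc (m ℕ.+ n))                ≈⟨ coeff-*-suc a p r (m ℕ.+ n) ⟩
    a * coeff r (suc (m ℕ.+ n)) + coeff (p *P r) (m ℕ.+ n)
      ≈⟨ +-cong (trans (*-congˡ r≈0) (zeroʳ a)) (leading-coeff-* p r p≤m r≤n) ⟩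
    0# + coeff p m * coeff r n                          ≈⟨ +-identityˡ _ ⟩
    coeff p m * coeff r n                               ∎
    where
    open SetoidReasoning setoid
    r≈0 : coeff r (suc (m ℕ.+ n)) ≈ 0#
    r≈0 = trans (reflexive (≡.cong (λ j → coeff r (suc j)) (ℕ.+-comm m n))) (r≤n m)

  nonZeroP⇒≉0 : ∀ {p} → NonZeroP p → ¬ p ≋ []
  nonZeroP⇒≉0 (here a≉0)   p≋0 = a≉0 (at p≋0 0)
  nonZeroP⇒≉0 (there p≉0)  p≋0 = nonZeroP⇒≉0 p≉0 (coeffwise λ k → at p≋0 (suc k))

  ≉0⇒nonZeroP : ∀ p → ¬ p ≋ [] → NonZeroP p
  ≉0⇒nonZeroP []      p≉0 = contradiction K[x].refl p≉0
  ≉0⇒nonZeroP (a ∷ p) p≉0 with a ≟ 0#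
  ... | no  a≉0 = here a≉0
  ... | yes a≈0 = there (≉0⇒nonZeroP p λ p≋0 → p≉0 (K[x].trans (∷-cong a≈0 p≋0) X·0))

  *P-cancel-0 : ∀ p r → ¬ p ≋ [] → (p *P r) ≋ [] → r ≋ []
  *P-cancel-0 p r p≉0 pr≋0 with zero-or-degree p | zero-or-degree r
  ... | inj₁ p≋0             | _                    = contradiction p≋0 p≉0
  ... | _                    | inj₁ r≋0             = r≋0
  ... | inj₂ (m , p-m , p≤m) | inj₂ (n , r-n , r≤n) = contradiction
    (trans (sym (leading-coeff-* p r p≤m r≤n)) (at pr≋0 (m ℕ.+ n))) (*-≉0 p-m r-n)

  *P-cancelˡ : ∀ p r s → ¬ p ≋ [] → (p *P r) ≋ (p *P s) → r ≋ s
  *P-cancelˡ p r s p≉0 e = begin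
    r                    ≈⟨ S.solve 2 (λ r s → r S.:= (r S.:- s) S.:+ s) K[x].refl r s ⟩
    (r +P (-P s)) +P s   ≈⟨ +P-cong {r' = s} r-s≋0 K[x].refl ⟩
    s                    ∎
    where
    open SetoidReasoning ≋-setoid
    r-s≋0 : (r +P (-P s)) ≋ []
    r-s≋0 = *P-cancel-0 p _ p≉0 (begin
      p *P (r +P (-P s))
        ≈⟨ S.solve 3 (λ p r s → p S.:* (r S.:- s) S.:= p S.:* r S.:- p S.:* s) K[x].refl p r s ⟩
      (p *P r) +P (-P (p *P s))   ≈⟨ +P-cong {r' = -P (p *P s)} e K[x].refl ⟩
      (p *P s) +P (-P (p *P s))   ≈⟨ -P-inverseʳ (p *P s) ⟩
      []                          ∎)

  -- If p had positive degree, the product of the two leading coefficients would be a nonzero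
  -- coefficient of the constant a in positive degree.
  unit-constant : ∀ p r {a} → ¬ a ≈ 0# → (p *P r) ≋ ⟪ a ⟫ → IsConstant p
  unit-constant p r a≉0 pr≋a with zero-or-degree p | zero-or-degree r
  ... | inj₁ p≋0             | _        = λ k → at p≋0 (suc k)
  ... | _                    | inj₁ r≋0 = contradiction
    (trans (sym (at pr≋a 0)) (at (K[x].trans (*P-congˡ p r≋0) (*P-zeroʳ p)) 0)) a≉0
  ... | inj₂ (zero  , p-m , p≤m) | inj₂ _ = p≤m
  ... | inj₂ (suc m , p-m , p≤m) | inj₂ (n , r-n , r≤n) = contradiction
    (trans (sym (leading-coeff-* p r p≤m r≤n)) (at pr≋a (suc m ℕ.+ n))) (*-≉0 p-m r-n)

-- Quadratic expressions and their cores.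

module QuadraticExpressions {κ ℓ} (K : CommutativeRing κ ℓ) (isField : IsField K)
                            (_≟_ : Decidable (CommutativeRing._≈_ K)) where
  open FieldPolynomials K isField _≟_ public
  open FiniteSetoids using (subsetoid)

  quad : Carrier → Carrier → Carrier → Poly
  quad a b c = a ∷ b ∷ c ∷ []

  quad-cong : ∀ {a b c a' b' c'} → a ≈ a' → b ≈ b' → c ≈ c' → quad a b c ≋ quad a' b' c'
  quad-cong e f g = ∷-cong e (∷-cong f (∷-cong g K[x].refl))

  degLe-2⇒quad : ∀ p → DegLe p 2 → p ≋ quad (coeff p 0) (coeff p 1) (coeff p 2)
  degLe-2⇒quad p le = coeffwise λ where
    0                   → refl
    1                   → refl
    2                   → refl
    (suc (suc (suc k))) → le k

  quad-* : ∀ s₀ s₁ s₂ h₀ h₁ h₂ → (quad s₀ s₁ s₂ *P quad h₀ h₁ h₂) ≋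
    (s₀ * h₀ ∷ s₀ * h₁ + s₁ * h₀ ∷ s₀ * h₂ + s₁ * h₁ + s₂ * h₀ ∷ s₁ * h₂ + s₂ * h₁ ∷ s₂ * h₂ ∷ [])
  quad-* s₀ s₁ s₂ h₀ h₁ h₂ =
    ∷-cong (+-identityʳ _) (
    ∷-cong (+-congˡ (+-identityʳ _)) (
    ∷-cong (trans (+-congˡ (+-congˡ (+-identityʳ _))) (sym (+-assoc _ _ _))) K[x].refl))

  NonZeroElement : Set _
  NonZeroElement = ∃ λ x → ¬ x ≈ 0#

  nonZeroElements : Setoid _ _
  nonZeroElements = subsetoid setoid {P = λ x → ¬ x ≈ 0#}

  -- Representatives of the left PGL₂-orbits on quadratic expressions: inj₁ u encodes x² + u x,
  -- and inj₂ (v , D) encodes (x² + D − v²)/(x + v) = x − v + D/(x + v).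
  Core : Set _
  Core = Carrier ⊎ (Carrier × NonZeroElement)

  cores : Setoid _ _
  cores = setoid ⊎ₛ (setoid ×ₛ nonZeroElements)

  coreNum₀ coreNum₁ coreDen₀ coreDen₁ : Core → Carrier
  coreNum₀ (inj₁ u)           = 0#
  coreNum₀ (inj₂ (v , D , _)) = D - v * v
  coreNum₁ (inj₁ u)           = u
  coreNum₁ (inj₂ _)           = 0#
  coreDen₀ (inj₁ u)           = 1#
  coreDen₀ (inj₂ (v , _))     = v
  coreDen₁ (inj₁ u)           = 0#
  coreDen₁ (inj₂ _)           = 1#

  coreNum coreDen : Core → Poly
  coreNum b = quad (coreNum₀ b) (coreNum₁ b) 1#
  coreDen b = quad (coreDen₀ b) (coreDen₁ b) 0#

  disc : Core → Carrier
  disc (inj₁ u)           = 1#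
  disc (inj₂ (v , D , _)) = D

  disc≉0 : ∀ b → ¬ disc b ≈ 0#
  disc≉0 (inj₁ u)             = 1≉0
  disc≉0 (inj₂ (v , D , D≉0)) = D≉0

  -- An explicit Bézout relation: a common divisor of the numerator and denominator of a core
  -- divides the nonzero constant `disc b`.
  core-bezout : ∀ b → ∃ λ U → ∃ λ V → ((U *P coreNum b) +P (V *P coreDen b)) ≋ ⟪ disc b ⟫
  core-bezout (inj₁ u) = [] , ⟪ 1# ⟫ , (begin
    ⟪ 1# ⟫ *P quad 1# 0# 0#   ≈⟨ *P-identityˡ _ ⟩
    quad 1# 0# 0#             ≈⟨ ∷-cong refl (K[x].trans (∷-cong refl X·0) X·0) ⟩
    ⟪ 1# ⟫                    ∎)
    where open SetoidReasoning ≋-setoid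
  -- The relation is (x² + D - v²) + (v - x)(x + v) = D.
  core-bezout (inj₂ (v , D , _)) = quad 1# 0# 0# , quad v (- 1#) 0# , (begin
    (quad 1# 0# 0# *P quad (D - v * v) 0# 1#) +P (quad v (- 1#) 0# *P quad v 1# 0#)
      ≈⟨ +P-cong {r = quad v (- 1#) 0# *P quad v 1# 0#} (quad-* _ _ _ _ _ _) (quad-* _ _ _ _ _ _) ⟩
    _
      ≈⟨ ∷-cong (solve 2 (λ v D → :1 :* (D :- v :* v) :+ v :* v := D) refl v D)
        (∷-cong (solve 2 (λ v D → :1 :* :0 :+ :0 :* (D :- v :* v) :+ (v :* :1 :+ :- :1 :* v) := :0) refl v D)
        (∷-cong (solve 2 (λ v D → :1 :* :1 :+ :0 :* :0 :+ :0 :* (D :- v :* v) :+ (v :* :0 :+ :- :1 :* :1 :+ :0 :* v) := :0) refl v D)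
        (∷-cong (solve 0 (:0 :* :1 :+ :0 :* :0 :+ (:- :1 :* :0 :+ :0 :* :1) := :0) refl)
        (∷-cong (solve 0 (:0 :* :1 :+ :0 :* :0 := :0) refl) K[x].refl)))) ⟩
    D ∷ 0# ∷ 0# ∷ 0# ∷ 0# ∷ []
      ≈⟨ coeffwise (λ { 0 → refl ; 1 → refl ; 2 → refl ; 3 → refl ; 4 → refl ; (suc (suc (suc (suc (suc k))))) → refl }) ⟩
    ⟪ D ⟫ ∎)
    where
    open SetoidReasoning ≋-setoid

  -- A reduced fraction of degree 2 determines its numerator and denominator up to a common scalar
  -- among polynomials of degree at most 2. The proof compares the coefficients of the products; l
  -- is read off where the core denominator has its pivot 1, so it is t₀ or t₁.
  proportional : ∀ b {s₀ s₁ s₂ t₀ t₁ t₂} →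
    (quad s₀ s₁ s₂ *P coreDen b) ≋ (quad t₀ t₁ t₂ *P coreNum b) →
    ∃ λ l → quad s₀ s₁ s₂ ≋ l ·P coreNum b × quad t₀ t₁ t₂ ≋ l ·P coreDen b
  proportional (inj₁ u) {s₀} {s₁} {s₂} {t₀} {t₁} {t₂} eq =
    t₀ , quad-cong S0 S1 S2 , quad-cong (sym (*-identityʳ t₀)) T1 T2
    where
    E = λ k → trans (sym (at (quad-* s₀ s₁ s₂ 1# 0# 0#) k))
          (trans (at eq k) (at (quad-* t₀ t₁ t₂ 0# u 1#) k))
    T2 : t₂ ≈ t₀ * 0#
    T2 = by (sym (E 4)) (solve 3 (λ t₀ t₂ s₂ →
           t₂ :- t₀ :* :0 := t₂ :* :1 :- s₂ :* :0) refl t₀ t₂ s₂)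
    T1 : t₁ ≈ t₀ * 0#
    T1 = by (+-cong (sym (E 3)) (*-congˡ { - u} T2)) (solve 6 (λ u s₁ s₂ t₀ t₁ t₂ →
           t₁ :- t₀ :* :0 := (t₁ :* :1 :+ t₂ :* u :+ :- u :* t₂) :- (s₁ :* :0 :+ s₂ :* :0 :+ :- u :* (t₀ :* :0)))
           refl u s₁ s₂ t₀ t₁ t₂)
    S0 : s₀ ≈ t₀ * 0#
    S0 = trans (sym (*-identityʳ s₀)) (E 0)
    S1 : s₁ ≈ t₀ * u
    S1 = by (E 1) (solve 5 (λ u s₀ s₁ t₀ t₁ →
           s₁ :- t₀ :* u := (s₀ :* :0 :+ s₁ :* :1) :- (t₀ :* u :+ t₁ :* :0)) refl u s₀ s₁ t₀ t₁)
    S2 : s₂ ≈ t₀ * 1#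
    S2 = by (+-cong (E 2) (*-congˡ {u} T1)) (solve 7 (λ u s₀ s₁ s₂ t₀ t₁ t₂ →
           s₂ :- t₀ :* :1 := (s₀ :* :0 :+ s₁ :* :0 :+ s₂ :* :1 :+ u :* t₁) :- (t₀ :* :1 :+ t₁ :* u :+ t₂ :* :0 :+ u :* (t₀ :* :0)))
           refl u s₀ s₁ s₂ t₀ t₁ t₂)
  proportional (inj₂ (v , D , D≉0)) {s₀} {s₁} {s₂} {t₀} {t₁} {t₂} eq =
    t₁ , quad-cong S0 (trans S1 (sym (zeroʳ t₁))) S2 , quad-cong T0 (sym (*-identityʳ t₁)) (trans T2 (sym (zeroʳ t₁)))
    where
    g₀ = D - v * v
    E = λ k → trans (sym (at (quad-* s₀ s₁ s₂ v 1# 0#) k))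
          (trans (at eq k) (at (quad-* t₀ t₁ t₂ g₀ 0# 1#) k))
    T2 : t₂ ≈ 0#
    T2 = trans (sym (*-identityʳ t₂)) (trans (sym (E 4)) (zeroʳ s₂))
    S2 : s₂ ≈ t₁ * 1#
    S2 = by (E 3) (solve 4 (λ s₁ s₂ t₁ t₂ →
           s₂ :- t₁ :* :1 := (s₁ :* :0 :+ s₂ :* :1) :- (t₁ :* :1 :+ t₂ :* :0)) refl s₁ s₂ t₁ t₂)
    T0' : t₀ ≈ s₁ + t₁ * v
    T0' = by (+-cong (sym (E 2)) (+-cong (*-congˡ {v} S2) (*-congˡ { - g₀} T2))) (solve 8 (λ v g₀ s₀ s₁ s₂ t₀ t₁ t₂ →
           t₀ :- (s₁ :+ t₁ :* v) := (t₀ :* :1 :+ t₁ :* :0 :+ t₂ :* g₀ :+ (v :* s₂ :+ :- g₀ :* t₂))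
             :- (s₀ :* :0 :+ s₁ :* :1 :+ s₂ :* v :+ (v :* (t₁ :* :1) :+ :- g₀ :* :0)))
           refl v g₀ s₀ s₁ s₂ t₀ t₁ t₂)
    S0' : s₀ ≈ t₁ * g₀ - s₁ * v
    S0' = by (E 1) (solve 6 (λ v g₀ s₀ s₁ t₀ t₁ →
           s₀ :- (t₁ :* g₀ :- s₁ :* v) := (s₀ :* :1 :+ s₁ :* v) :- (t₀ :* :0 :+ t₁ :* g₀)) refl v g₀ s₀ s₁ t₀ t₁)
    -- Coprimality enters here: after elimination of s₀ and t₀ the equation of the constant terms
    -- becomes D s₁ = 0.
    S1 : s₁ ≈ 0#
    S1 = *-cancel-0 D≉0 (by (+-cong (sym (E 0)) (+-cong (*-congˡ {v} S0') (*-congˡ { - g₀} T0'))) (solve 6 (λ v D s₀ s₁ t₀ t₁ →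
           let g₀ = D :- v :* v in
           D :* s₁ :- :0 := (t₀ :* g₀ :+ (v :* s₀ :+ :- g₀ :* t₀))
             :- (s₀ :* v :+ (v :* (t₁ :* g₀ :- s₁ :* v) :+ :- g₀ :* (s₁ :+ t₁ :* v))))
           refl v D s₀ s₁ t₀ t₁))
    S0 : s₀ ≈ t₁ * g₀
    S0 = by (+-cong S0' (*-congˡ { - v} S1)) (solve 5 (λ v g₀ s₀ s₁ t₁ →
           s₀ :- t₁ :* g₀ := (s₀ :+ :- v :* s₁) :- (t₁ :* g₀ :- s₁ :* v :+ :- v :* :0)) refl v g₀ s₀ s₁ t₁)
    T0 : t₀ ≈ t₁ * v
    T0 = trans T0' (trans (+-congʳ S1) (+-identityˡ _))

  divide : ∀ x {y} → ¬ y ≈ 0# → ∃ λ z → y * z ≈ x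
  divide x {y} y≉0 = let y⁻¹ , yy⁻¹≈1 = proj₂ isField y y≉0 in
    y⁻¹ * x , trans (sym (*-assoc y y⁻¹ x)) (trans (*-congʳ yy⁻¹≈1) (*-identityˡ x))

  det : Mobius → Carrier
  det M = ma M * md M - mb M * mc M

  lin : Carrier → Poly → Carrier → Poly → Poly
  lin a p b r = (a ·P p) +P (b ·P r)

  lin≋ : ∀ a p b r → lin a p b r ≋ ((⟪ a ⟫ *P p) +P (⟪ b ⟫ *P r))
  lin≋ a p b r = +P-cong (K[x].sym (⟪⟫-* a p)) (K[x].sym (⟪⟫-* b r))

  lin-cong : ∀ {a b a' b'} p r → a ≈ a' → b ≈ b' → lin a p b r ≋ lin a' p b' r
  lin-cong p r e f = +P-cong (·P-cong e (K[x].refl {p})) (·P-cong f (K[x].refl {r}))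

  num∘ den∘ : Mobius → Poly → Poly → Poly
  num∘ M p r = lin (ma M) p (mb M) r
  den∘ M p r = lin (mc M) p (md M) r

  -- The adjugate stands for the inverse of M without division by the determinant: s/t = M(g/h)
  -- turns into adj(M)(s/t) = g/h, and the two cross-multiplied differences are the same polynomial.
  adjugate-transfer : ∀ M g h s t →
    (s *P den∘ M g h) ≋ (num∘ M g h *P t) →
    (lin (md M) s (- mb M) t *P h) ≋ (lin (ma M) t (- mc M) s *P g)
  adjugate-transfer (mob a b c d _) g h s t e = begin
    lin d s (- b) t *P h
      ≈⟨ *P-cong (lin≋ d s (- b) t) (K[x].refl {h}) ⟩
    ((⟪ d ⟫ *P s) +P (⟪ - b ⟫ *P t)) *P h
      ≈⟨ S.by e' (S.solve 8 (λ a b c d g h s t →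
           (d S.:* s S.:+ S.:- b S.:* t) S.:* h S.:- (a S.:* t S.:+ S.:- c S.:* s) S.:* g
           S.:= s S.:* (c S.:* g S.:+ d S.:* h) S.:- (a S.:* g S.:+ b S.:* h) S.:* t)
           K[x].refl ⟪ a ⟫ ⟪ b ⟫ ⟪ c ⟫ ⟪ d ⟫ g h s t) ⟩
    ((⟪ a ⟫ *P t) +P (⟪ - c ⟫ *P s)) *P g
      ≈⟨ *P-cong (lin≋ a t (- c) s) (K[x].refl {g}) ⟨
    lin a t (- c) s *P g
      ∎
    where
    open SetoidReasoning ≋-setoid
    e' : (s *P ((⟪ c ⟫ *P g) +P (⟪ d ⟫ *P h))) ≋ (((⟪ a ⟫ *P g) +P (⟪ b ⟫ *P h)) *P t)
    e' = K[x].trans (*P-congˡ s (K[x].sym (lin≋ c g d h)))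
           (K[x].trans e (*P-cong (lin≋ a g b h) (K[x].refl {t})))

  proportional∘ : ∀ M b {s₀ s₁ s₂ t₀ t₁ t₂} →
    let s = quad s₀ s₁ s₂ ; t = quad t₀ t₁ t₂ in
    (s *P den∘ M (coreNum b) (coreDen b)) ≋ (num∘ M (coreNum b) (coreDen b) *P t) →
    ∃ λ l → lin (md M) s (- mb M) t ≋ l ·P coreNum b × lin (ma M) t (- mc M) s ≋ l ·P coreDen b
  proportional∘ M b {s₀} {s₁} {s₂} {t₀} {t₁} {t₂} e =
    proportional b (adjugate-transfer M (coreNum b) (coreDen b) (quad s₀ s₁ s₂) (quad t₀ t₁ t₂) e)

  -- A quarter of the discriminant of the Wronskian s' t − s t'.
  wronskianDisc : (s₀ s₁ s₂ t₀ t₁ t₂ : Carrier) → Carrier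
  wronskianDisc s₀ s₁ s₂ t₀ t₁ t₂ =
    (s₂ * t₀ - s₀ * t₂) * (s₂ * t₀ - s₀ * t₂) - (s₂ * t₁ - s₁ * t₂) * (s₁ * t₀ - s₀ * t₁)

  wronskianDisc-core : ∀ b →
    wronskianDisc (coreNum₀ b) (coreNum₁ b) 1# (coreDen₀ b) (coreDen₁ b) 0# ≈ disc b
  wronskianDisc-core (inj₁ u) = solve 1 (λ u →
    let w₁ = :1 :* :1 :- :0 :* :0 in w₁ :* w₁ :- (:1 :* :0 :- u :* :0) :* (u :* :1 :- :0 :* :0) := :1) refl u
  wronskianDisc-core (inj₂ (v , D , _)) = solve 2 (λ v D →
    let g = D :- v :* v ; w₁ = :1 :* v :- g :* :0 in
    w₁ :* w₁ :- (:1 :* :1 :- :0 :* :0) :* (:0 :* v :- g :* :1) := D) refl v D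

  wronskianDisc-cong : ∀ {s₀ s₁ s₂ t₀ t₁ t₂ s₀' s₁' s₂' t₀' t₁' t₂'} →
    quad s₀ s₁ s₂ ≋ quad s₀' s₁' s₂' → quad t₀ t₁ t₂ ≋ quad t₀' t₁' t₂' →
    wronskianDisc s₀ s₁ s₂ t₀ t₁ t₂ ≈ wronskianDisc s₀' s₁' s₂' t₀' t₁' t₂'
  wronskianDisc-cong s t = +-cong (*-cong w₂₀ w₂₀) (-‿cong (*-cong
      (minor (at s 2) (at t 1) (at s 1) (at t 2)) (minor (at s 1) (at t 0) (at s 0) (at t 1))))
    where
    minor : ∀ {x y z w x' y' z' w'} → x ≈ x' → y ≈ y' → z ≈ z' → w ≈ w' → x * y - z * w ≈ x' * y' - z' * w'
    minor e f g h = +-cong (*-cong e f) (-‿cong (*-cong g h))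
    w₂₀ = minor (at s 2) (at t 0) (at s 0) (at t 2)

  -- `wronskianDisc` is a quadratic form in the three 2 × 2 minors of the coefficient matrix. A
  -- common factor l of s and t multiplies every minor by l², and a linear change of the pair (s, t)
  -- multiplies it by the determinant.
  wronskianDisc-minors : ∀ {δ s₀ s₁ s₂ t₀ t₁ t₂ s₀' s₁' s₂' t₀' t₁' t₂'} →
    s₂' * t₀' - s₀' * t₂' ≈ δ * (s₂ * t₀ - s₀ * t₂) →
    s₂' * t₁' - s₁' * t₂' ≈ δ * (s₂ * t₁ - s₁ * t₂) →
    s₁' * t₀' - s₀' * t₁' ≈ δ * (s₁ * t₀ - s₀ * t₁) →
    wronskianDisc s₀' s₁' s₂' t₀' t₁' t₂' ≈ δ * δ * wronskianDisc s₀ s₁ s₂ t₀ t₁ t₂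
  wronskianDisc-minors {δ} e f g = trans
    (+-cong (*-cong e e) (-‿cong (*-cong f g)))
    (solve 4 (λ δ x y z → δ :* x :* (δ :* x) :- δ :* y :* (δ :* z) := δ :* δ :* (x :* x :- y :* z)) refl δ _ _ _)

  wronskianDisc-scale : ∀ l s₀ s₁ s₂ t₀ t₁ t₂ →
    wronskianDisc (l * s₀) (l * s₁) (l * s₂) (l * t₀) (l * t₁) (l * t₂)
      ≈ l * l * (l * l) * wronskianDisc s₀ s₁ s₂ t₀ t₁ t₂
  wronskianDisc-scale l s₀ s₁ s₂ t₀ t₁ t₂ =
    wronskianDisc-minors (minor s₂ s₀ t₂ t₀) (minor s₂ s₁ t₂ t₁) (minor s₁ s₀ t₁ t₀)
    where
    minor : ∀ x y x' y' → l * x * (l * y') - l * y * (l * x') ≈ l * l * (x * y' - y * x')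
    minor = solve 5 (λ l x y x' y' →
      l :* x :* (l :* y') :- l :* y :* (l :* x') := l :* l :* (x :* y' :- y :* x')) refl l

  wronskianDisc-adjugate : ∀ a b c d s₀ s₁ s₂ t₀ t₁ t₂ →
    wronskianDisc (d * s₀ + - b * t₀) (d * s₁ + - b * t₁) (d * s₂ + - b * t₂)
                  (a * t₀ + - c * s₀) (a * t₁ + - c * s₁) (a * t₂ + - c * s₂)
      ≈ (a * d - b * c) * (a * d - b * c) * wronskianDisc s₀ s₁ s₂ t₀ t₁ t₂
  wronskianDisc-adjugate a b c d s₀ s₁ s₂ t₀ t₁ t₂ =
    wronskianDisc-minors (minor s₂ s₀ t₂ t₀) (minor s₂ s₁ t₂ t₁) (minor s₁ s₀ t₁ t₀)
    where
    minor : ∀ x y x' y' → (d * x + - b * x') * (a * y' + - c * y) - (d * y + - b * y') * (a * x' + - c * x)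
                            ≈ (a * d - b * c) * (x * y' - y * x')
    minor = solve 8 (λ a b c d x y x' y' →
      (d :* x :+ :- b :* x') :* (a :* y' :+ :- c :* y) :- (d :* y :+ :- b :* y') :* (a :* x' :+ :- c :* x)
      := (a :* d :- b :* c) :* (x :* y' :- y :* x')) refl a b c d

  -- Both sides evaluate `wronskianDisc` on adj(M)(s, t) = l · core. Since the factors l⁴ and
  -- det(M)² are squares, the square class of `disc B` can be read off from s and t; that l ≠ 0 is
  -- derived only in `square-ratio`.
  disc-transfer : ∀ M B {s₀ s₁ s₂ t₀ t₁ t₂} →
    (quad s₀ s₁ s₂ *P den∘ M (coreNum B) (coreDen B)) ≋ (num∘ M (coreNum B) (coreDen B) *P quad t₀ t₁ t₂) →
    ∃ λ l → l * l * (l * l) * disc B ≈ det M * det M * wronskianDisc s₀ s₁ s₂ t₀ t₁ t₂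
  disc-transfer M@(mob a b c d _) B {s₀} {s₁} {s₂} {t₀} {t₁} {t₂} e
    = let l , e₁ , e₂ = proportional∘ M B {s₀} {s₁} {s₂} {t₀} {t₁} {t₂} e in l , (begin
      l * l * (l * l) * disc B
        ≈⟨ *-congˡ (wronskianDisc-core B) ⟨
      l * l * (l * l) * wronskianDisc g₀ g₁ 1# h₀ h₁ 0#
        ≈⟨ wronskianDisc-scale l g₀ g₁ 1# h₀ h₁ 0# ⟨
      wronskianDisc (l * g₀) (l * g₁) (l * 1#) (l * h₀) (l * h₁) (l * 0#)
        ≈⟨ wronskianDisc-cong e₁ e₂ ⟨
      wronskianDisc (d * s₀ + - b * t₀) (d * s₁ + - b * t₁) (d * s₂ + - b * t₂)
                    (a * t₀ + - c * s₀) (a * t₁ + - c * s₁) (a * t₂ + - c * s₂)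
        ≈⟨ wronskianDisc-adjugate a b c d s₀ s₁ s₂ t₀ t₁ t₂ ⟩
      (a * d - b * c) * (a * d - b * c) * wronskianDisc s₀ s₁ s₂ t₀ t₁ t₂
        ∎)
    where
    open SetoidReasoning setoid
    g₀ = coreNum₀ B
    g₁ = coreNum₁ B
    h₀ = coreDen₀ B
    h₁ = coreDen₁ B

  -- The expressions M ∘ core: coprimality, normalisation, uniqueness.

  fracNum fracDen : Mobius → Core → Poly
  fracNum M B = num∘ M (coreNum B) (coreDen B)
  fracDen M B = den∘ M (coreNum B) (coreDen B)

  coreDen-≉0 : ∀ B {x} → x * coreDen₀ B ≈ 0# → x * coreDen₁ B ≈ 0# → x ≈ 0#
  coreDen-≉0 (inj₁ u) x·h₀≈0 x·h₁≈0 = trans (sym (*-identityʳ _)) x·h₀≈0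
  coreDen-≉0 (inj₂ _) x·h₀≈0 x·h₁≈0 = trans (sym (*-identityʳ _)) x·h₁≈0

  det-row₂≈0 : ∀ M → mc M ≈ 0# → md M ≈ 0# → det M ≈ 0#
  det-row₂≈0 (mob a b c d _) c≈0 d≈0 = trans
    (+-cong (*-congˡ d≈0) (-‿cong (*-congˡ c≈0)))
    (solve 2 (λ a b → a :* :0 :- b :* :0 := :0) refl a b)

  det-col₁≈0 : ∀ M → ma M ≈ 0# → mc M ≈ 0# → det M ≈ 0#
  det-col₁≈0 (mob a b c d _) a≈0 c≈0 = trans
    (+-cong (*-congʳ a≈0) (-‿cong (*-congˡ c≈0)))
    (solve 2 (λ b d → :0 :* d :- b :* :0 := :0) refl b d)

  drop-0 : ∀ x y → x * 1# + y * 0# ≈ x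
  drop-0 = solve 2 (λ x y → x :* :1 :+ y :* :0 := x) refl

  -- Only the core numerator has an x² term, and it is monic, so the x² coefficient of c g + d h is
  -- c. Once c = 0, a vanishing d h with h ≠ 0 gives d = 0, and the bottom row of M would be zero.
  fracDen≉0 : ∀ M B → ¬ fracDen M B ≋ []
  fracDen≉0 M@(mob a b c d det≠0) B e = det≠0 (det-row₂≈0 M c≈0 d≈0)
    where
    c≈0 : c ≈ 0#
    c≈0 = trans (sym (drop-0 c d)) (at e 2)
    d·h : ∀ {g h} → c * g + d * h ≈ 0# → d * h ≈ 0#
    d·h {g} {h} e = trans (sym (trans (+-congʳ (trans (*-congʳ c≈0) (zeroˡ g))) (+-identityˡ _))) e
    d≈0 : d ≈ 0#
    d≈0 = coreDen-≉0 B (d·h (at e 0)) (d·h (at e 1))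

  frac : Mobius → Core → RatExpr
  frac M B = fracNum M B / fracDen M B [ ≉0⇒nonZeroP _ (fracDen≉0 M B) ]

  -- The adjugate recovers det(M) g and det(M) h from the new numerator and denominator, and the
  -- Bézout relation of the core then makes every common divisor divide the nonzero constant det(M)
  -- · `disc B`.
  frac-coprime : ∀ M B → Coprime (fracNum M B) (fracDen M B)
  frac-coprime (mob a b c d det≠0) B p (e , pe≈) (f , pf≈) =
    let U , V , UG+VH≋D = core-bezout B
        cofactor = (U *P lin d e (- b) f) +P (V *P lin a f (- c) e)
    in unit-constant p cofactor (*-≉0 det≠0 (disc≉0 B)) (begin
    p *P ((U *P lin d e (- b) f) +P (V *P lin a f (- c) e))
      ≈⟨ *P-congˡ p (+P-cong (*P-congˡ U (lin≋ d e (- b) f)) (*P-congˡ V (lin≋ a f (- c) e))) ⟩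
    p *P ((U *P ((⟪ d ⟫ *P e) +P (⟪ - b ⟫ *P f))) +P (V *P ((⟪ a ⟫ *P f) +P (⟪ - c ⟫ *P e))))
      ≈⟨ S.solve 9 (λ a b c d p e f U V →
           p S.:* (U S.:* (d S.:* e S.:+ S.:- b S.:* f) S.:+ V S.:* (a S.:* f S.:+ S.:- c S.:* e))
           S.:= U S.:* (d S.:* (p S.:* e) S.:+ S.:- b S.:* (p S.:* f)) S.:+ V S.:* (a S.:* (p S.:* f) S.:+ S.:- c S.:* (p S.:* e)))
           K[x].refl ⟪ a ⟫ ⟪ b ⟫ ⟪ c ⟫ ⟪ d ⟫ p e f U V ⟩
    combination U V (p *P e) (p *P f)
      ≈⟨ +P-cong (*P-congˡ U (+P-cong (*P-congˡ ⟪ d ⟫ pe) (*P-congˡ ⟪ - b ⟫ pf)))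
                 (*P-congˡ V (+P-cong (*P-congˡ ⟪ a ⟫ pf) (*P-congˡ ⟪ - c ⟫ pe))) ⟩
    combination U V ((⟪ a ⟫ *P G) +P (⟪ b ⟫ *P H)) ((⟪ c ⟫ *P G) +P (⟪ d ⟫ *P H))
      ≈⟨ S.solve 8 (λ a b c d U V G H →
           let P = a S.:* G S.:+ b S.:* H ; Q = c S.:* G S.:+ d S.:* H in
           U S.:* (d S.:* P S.:+ S.:- b S.:* Q) S.:+ V S.:* (a S.:* Q S.:+ S.:- c S.:* P)
           S.:= (a S.:* d S.:- b S.:* c) S.:* (U S.:* G S.:+ V S.:* H))
           K[x].refl ⟪ a ⟫ ⟪ b ⟫ ⟪ c ⟫ ⟪ d ⟫ U V G H ⟩
    ((⟪ a ⟫ *P ⟪ d ⟫) +P (-P (⟪ b ⟫ *P ⟪ c ⟫))) *P ((U *P G) +P (V *P H))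
      ≈⟨ *P-cong constant UG+VH≋D ⟩
    ⟪ a * d - b * c ⟫ *P ⟪ disc B ⟫
      ≈⟨ ⟪⟫-* _ _ ⟩
    ⟪ (a * d - b * c) * disc B ⟫ ∎)
    where
    open SetoidReasoning ≋-setoid
    G = coreNum B
    H = coreDen B
    pe : (p *P e) ≋ ((⟪ a ⟫ *P G) +P (⟪ b ⟫ *P H))
    pe = K[x].trans (coeffwise pe≈) (lin≋ a G b H)
    pf : (p *P f) ≋ ((⟪ c ⟫ *P G) +P (⟪ d ⟫ *P H))
    pf = K[x].trans (coeffwise pf≈) (lin≋ c G d H)
    combination : Poly → Poly → Poly → Poly → Poly
    combination U V P Q = (U *P ((⟪ d ⟫ *P P) +P (⟪ - b ⟫ *P Q))) +P (V *P ((⟪ a ⟫ *P Q) +P (⟪ - c ⟫ *P P)))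
    constant : ((⟪ a ⟫ *P ⟪ d ⟫) +P (-P (⟪ b ⟫ *P ⟪ c ⟫))) ≋ ⟪ a * d - b * c ⟫
    constant = ∷-cong (+-cong (+-identityʳ _) (-‿cong (+-identityʳ _))) K[x].refl

  frac-isQuadratic : ∀ M B → IsQuadratic (frac M B)
  frac-isQuadratic M@(mob a b c d det≠0) B =
    frac M B , (λ _ → refl) , frac-coprime M B , (λ _ → refl) , (λ _ → refl) , leading
    where
    -- The x² coefficients are a and c, the first column of an invertible matrix.
    leading : ¬ (a * 1# + b * 0# ≈ 0#) ⊎ ¬ (c * 1# + d * 0# ≈ 0#)
    leading with a ≟ 0# | c ≟ 0#
    ... | no a≉0  | _       = inj₁ λ e → a≉0 (trans (sym (drop-0 a b)) e)
    ... | yes _   | no c≉0  = inj₂ λ e → c≉0 (trans (sym (drop-0 c d)) e)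
    ... | yes a≈0 | yes c≈0 = contradiction (det-col₁≈0 M a≈0 c≈0) det≠0

  -- Representatives of PGL₂(K), normalised by making the first nonzero entry of the bottom row
  -- equal to 1: inj₁ (a , d , δ) encodes (a x + (a d − δ))/(x + d), and inj₂ (a , b) encodes a x + b.
  Normal : Set _
  Normal = (Carrier × Carrier × NonZeroElement) ⊎ (NonZeroElement × Carrier)

  normals : Setoid _ _
  normals = (setoid ×ₛ (setoid ×ₛ nonZeroElements)) ⊎ₛ (nonZeroElements ×ₛ setoid)

  toMobius : Normal → Mobius
  toMobius (inj₁ (a , d , δ , δ≉0)) = mob a (a * d - δ) 1# d λ e → δ≉0
    (trans (solve 3 (λ a d δ → δ := a :* d :- (a :* d :- δ) :* :1) refl a d δ) e)
  toMobius (inj₂ ((a , a≉0) , b))   = mob a b 0# 1# λ e → a≉0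
    (trans (solve 2 (λ a b → a := a :* :1 :- b :* :0) refl a b) e)

  -- The scalar μ is c, or d if c = 0. It is returned because it will multiply numerator and
  -- denominator alike and cancel.
  normalise : ∀ M → ∃ λ N → ∃ λ μ → ¬ μ ≈ 0# ×
    (ma M ≈ μ * ma (toMobius N)) × (mb M ≈ μ * mb (toMobius N)) ×
    (mc M ≈ μ * mc (toMobius N)) × (md M ≈ μ * md (toMobius N))
  normalise M@(mob a b c d det≠0) with c ≟ 0#
  ... | yes c≈0 =
    let a' , da'≈a = divide a d≉0
        b' , db'≈b = divide b d≉0
    in inj₂ ((a' , λ a'≈0 → a≉0 (trans (sym da'≈a) (trans (*-congˡ a'≈0) (zeroʳ d)))) , b') , d , d≉0 ,
       sym da'≈a , sym db'≈b , trans c≈0 (sym (zeroʳ d)) , sym (*-identityʳ d)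
    where
    a≉0 : ¬ a ≈ 0#
    a≉0 a≈0 = det≠0 (det-col₁≈0 M a≈0 c≈0)
    d≉0 : ¬ d ≈ 0#
    d≉0 d≈0 = det≠0 (det-row₂≈0 M c≈0 d≈0)
  ... | no c≉0 =
    let a' , ca'≈a = divide a c≉0
        d' , cd'≈d = divide d c≉0
        b' , cb'≈b = divide b c≉0
        δ = a' * d' - b'
        c²δ≈det : c * c * δ ≈ a * d - b * c
        c²δ≈det = trans
          (solve 4 (λ a d b c → c :* c :* (a :* d :- b) := c :* a :* (c :* d) :- c :* b :* c) refl a' d' b' c)
          (+-cong (*-cong ca'≈a cd'≈d) (-‿cong (*-congʳ cb'≈b)))
    in inj₁ (a' , d' , δ , λ δ≈0 → det≠0 (trans (sym c²δ≈det) (trans (*-congˡ δ≈0) (zeroʳ _)))) , c , c≉0 ,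
       sym ca'≈a ,
       trans (sym cb'≈b) (*-congˡ (solve 2 (λ x b → b := x :- (x :- b)) refl (a' * d') b')) ,
       sym (*-identityʳ c) , sym cd'≈d

  -- Comparing the bottom rows, whose first nonzero entry is 1 on both sides, excludes different
  -- shapes and forces l = x.
  normal-rigid : ∀ M N x l → ¬ x ≈ 0# →
    let A = toMobius M ; B = toMobius N in
    x * ma A ≈ l * ma B → x * mb A ≈ l * mb B → x * mc A ≈ l * mc B → x * md A ≈ l * md B →
    Setoid._≈_ normals M N
  normal-rigid (inj₁ (a , d , δ , _)) (inj₁ (a' , d' , δ' , _)) x l x≉0 ea eb ec ed =
    inj₁ (a≈a' , d≈d' , by (+-cong (sym b≈b') (*-cong a≈a' d≈d'))
      (solve 4 (λ ad δ ad' δ' → δ :- δ' := (ad' :- δ' :+ ad) :- (ad :- δ :+ ad')) refl (a * d) δ (a' * d') δ'))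
    where
    l≈x : l ≈ x
    l≈x = *-cancelˡ 1≉0 (trans (*-comm 1# l) (trans (sym ec) (*-comm x 1#)))
    cancel : ∀ {y z} → x * y ≈ l * z → y ≈ z
    cancel e = *-cancelˡ x≉0 (trans e (*-congʳ l≈x))
    a≈a' = cancel ea
    b≈b' = cancel eb
    d≈d' = cancel ed
  normal-rigid (inj₁ _) (inj₂ _) x l x≉0 ea eb ec ed =
    contradiction (trans (sym (*-identityʳ x)) (trans ec (zeroʳ l))) x≉0
  normal-rigid (inj₂ _) (inj₁ _) x l x≉0 ea eb ec ed =
    contradiction (*-cancel-0 x≉0 (trans (*-comm x 1#) (trans (*-identityˡ x) x≈0))) 1≉0
    where
    l≈0 : l ≈ 0#
    l≈0 = trans (sym (*-identityʳ l)) (trans (sym ec) (zeroʳ x))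
    x≈0 : x ≈ 0#
    x≈0 = trans (sym (*-identityʳ x)) (trans ed (trans (*-congʳ l≈0) (zeroˡ _)))
  normal-rigid (inj₂ ((a , _) , b)) (inj₂ ((a' , _) , b')) x l x≉0 ea eb ec ed =
    inj₂ (cancel ea , cancel eb)
    where
    l≈x : l ≈ x
    l≈x = trans (sym (*-identityʳ l)) (trans (sym ed) (*-identityʳ x))
    cancel : ∀ {y z} → x * y ≈ l * z → y ≈ z
    cancel e = *-cancelˡ x≉0 (trans e (*-congʳ l≈x))

  -- Uniqueness of the reduced echelon basis: P carries one such basis to a multiple of another, so
  -- P is the scalar matrix l and the bases agree. The x² coefficients already give p = l and r = 0.
  core-rigid : ∀ P B B' l →
    fracNum P B ≋ l ·P coreNum B' → fracDen P B ≋ l ·P coreDen B' →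
    Setoid._≈_ cores B B' × ma P ≈ l × mb P ≈ 0# × mc P ≈ 0# × md P ≈ l
  core-rigid P@(mob p q r s det≠0) B B' l eNum eDen = rigid B B' eNum eDen
    where
    p≈l : p ≈ l
    p≈l = trans (sym (drop-0 p q)) (trans (at eNum 2) (*-identityʳ l))
    r≈0 : r ≈ 0#
    r≈0 = trans (sym (drop-0 r s)) (trans (at eDen 2) (zeroʳ l))
    s≉0 : ¬ s ≈ 0#
    s≉0 s≈0 = det≠0 (det-row₂≈0 P r≈0 s≈0)
    l≉0 : ¬ l ≈ 0#
    l≉0 l≈0 = det≠0 (det-col₁≈0 P (trans p≈l l≈0) r≈0)
    s·h : ∀ {g h h'} → r * g + s * h ≈ l * h' → s * h ≈ l * h'
    s·h {g} {h} e = trans (sym (trans (+-congʳ (trans (*-congʳ r≈0) (zeroˡ g))) (+-identityˡ _))) e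
    q≈0-if : p * 0# + q * 1# ≈ l * 0# → q ≈ 0#
    q≈0-if e = by e (solve 3 (λ p q l → q :- :0 := p :* :0 :+ q :* :1 :- l :* :0) refl p q l)
    p·g : ∀ {g h g'} → q ≈ 0# → p * g + q * h ≈ l * g' → g ≈ g'
    p·g {g} {h} q≈0 e = *-cancelˡ l≉0 (trans (*-congʳ (sym p≈l))
      (trans (sym (trans (+-congˡ (trans (*-congʳ q≈0) (zeroˡ h))) (+-identityʳ _))) e))
    s≈l-if : s * 1# ≈ l * 1# → s ≈ l
    s≈l-if e = trans (sym (*-identityʳ s)) (trans e (*-identityʳ l))
    rigid : ∀ B B' → fracNum P B ≋ l ·P coreNum B' → fracDen P B ≋ l ·P coreDen B' →
            Setoid._≈_ cores B B' × p ≈ l × q ≈ 0# × r ≈ 0# × s ≈ l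
    rigid (inj₁ u) (inj₁ u') eN eD =
      let q≈0 = q≈0-if (at eN 0) in
      inj₁ (p·g q≈0 (at eN 1)) , p≈l , q≈0 , r≈0 , s≈l-if (s·h (at eD 0))
    rigid (inj₁ u) (inj₂ _) eN eD =
      contradiction (trans (sym (*-identityʳ l)) (trans (sym (s·h (at eD 1))) (zeroʳ s))) l≉0
    rigid (inj₂ _) (inj₁ u') eN eD =
      contradiction (trans (sym (*-identityʳ s)) (trans (s·h (at eD 1)) (zeroʳ l))) s≉0
    rigid (inj₂ (v , D , _)) (inj₂ (v' , D' , _)) eN eD =
      let q≈0 = q≈0-if (at eN 1)
          s≈l = s≈l-if (s·h (at eD 1))
          v≈v' = *-cancelˡ l≉0 (trans (*-congʳ (sym s≈l)) (s·h (at eD 0)))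
          D≈D' = by (+-cong (p·g q≈0 (at eN 0)) (*-cong v≈v' v≈v'))
            (solve 4 (λ D vv D' vv' → D :- D' := (D :- vv :+ vv) :- (D' :- vv' :+ vv')) refl D (v * v) D' (v' * v'))
      in inj₂ (v≈v' , D≈D') , p≈l , q≈0 , r≈0 , s≈l

  frac-injective : ∀ M N B B' → frac (toMobius M) B ≈R frac (toMobius N) B' →
    Setoid._≈_ normals M N × Setoid._≈_ cores B B'
  frac-injective M N B B' e =
    let l , eNum , eDen = proportional∘ (toMobius N) B' {a * g₀ + b * h₀} {a * g₁ + b * h₁} {a * 1# + b * 0#}
                            {c * g₀ + d * h₀} {c * g₁ + d * h₁} {c * 1# + d * 0#} (coeffwise e)
        B≈B' , p≈l , q≈0 , r≈0 , s≈l = core-rigid P B B' l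
          (K[x].trans (quad-cong (compose a b c d a' b' g₀ h₀ d') (compose a b c d a' b' g₁ h₁ d') (compose a b c d a' b' 1# 0# d')) eNum)
          (K[x].trans (quad-cong (compose' g₀ h₀) (compose' g₁ h₁) (compose' 1# 0#)) eDen)
    -- Since P = adj(N) M is the scalar l, the identity N · P = det(N) M reads det(N) M = l N; the
    -- four arguments are its entries.
    in normal-rigid M N (det (toMobius N)) l (det≠0 (toMobius N))
         (entry p≈l r≈0 (solve 6 (λ a c a' b' c' d' →
           (a' :* d' :- b' :* c') :* a := a' :* (d' :* a :- b' :* c) :+ b' :* (a' :* c :- c' :* a)) refl a c a' b' c' d'))
         (entry' q≈0 s≈l (solve 6 (λ a c a' b' c' d' →
           (a' :* d' :- b' :* c') :* a := a' :* (d' :* a :- b' :* c) :+ b' :* (a' :* c :- c' :* a)) refl b d a' b' c' d'))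
         (entry p≈l r≈0 (solve 6 (λ a c a' b' c' d' →
           (a' :* d' :- b' :* c') :* c := c' :* (d' :* a :- b' :* c) :+ d' :* (a' :* c :- c' :* a)) refl a c a' b' c' d'))
         (entry' q≈0 s≈l (solve 6 (λ a c a' b' c' d' →
           (a' :* d' :- b' :* c') :* c := c' :* (d' :* a :- b' :* c) :+ d' :* (a' :* c :- c' :* a)) refl b d a' b' c' d'))
       , B≈B'
    where
    g₀ = coreNum₀ B
    g₁ = coreNum₁ B
    h₀ = coreDen₀ B
    h₁ = coreDen₁ B
    a = ma (toMobius M)
    b = mb (toMobius M)
    c = mc (toMobius M)
    d = md (toMobius M)
    a' = ma (toMobius N)
    b' = mb (toMobius N)
    c' = mc (toMobius N)
    d' = md (toMobius N)
    P : Mobius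
    P = mob (d' * a - b' * c) (d' * b - b' * d) (a' * c - c' * a) (a' * d - c' * b)
      λ e → *-≉0 (det≠0 (toMobius N)) (det≠0 (toMobius M)) (trans (solve 8 (λ a b c d a' b' c' d' →
        (a' :* d' :- b' :* c') :* (a :* d :- b :* c)
        := (d' :* a :- b' :* c) :* (a' :* d :- c' :* b) :- (d' :* b :- b' :* d) :* (a' :* c :- c' :* a))
        refl a b c d a' b' c' d') e)
    compose : ∀ a b c d a' b' g h d' → (d' * a - b' * c) * g + (d' * b - b' * d) * h ≈ d' * (a * g + b * h) + - b' * (c * g + d * h)
    compose = solve 9 (λ a b c d a' b' g h d' →
      (d' :* a :- b' :* c) :* g :+ (d' :* b :- b' :* d) :* h := d' :* (a :* g :+ b :* h) :+ :- b' :* (c :* g :+ d :* h)) refl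
    compose' : ∀ g h → (a' * c - c' * a) * g + (a' * d - c' * b) * h ≈ a' * (c * g + d * h) + - c' * (a * g + b * h)
    compose' = solve 8 (λ a b c d a' c' g h →
      (a' :* c :- c' :* a) :* g :+ (a' :* d :- c' :* b) :* h := a' :* (c :* g :+ d :* h) :+ :- c' :* (a :* g :+ b :* h)) refl a b c d a' c'
    entry : ∀ {x y z w l p} → p ≈ l → w ≈ 0# → x ≈ y * p + z * w → x ≈ l * y
    entry {y = y} {z} {w} {l} p≈l w≈0 e = trans e (trans (+-cong (*-congˡ p≈l) (*-congˡ w≈0))
      (solve 3 (λ y z l → y :* l :+ z :* :0 := l :* y) refl y z l))
    entry' : ∀ {x y z w l p} → p ≈ 0# → w ≈ l → x ≈ y * p + z * w → x ≈ l * z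
    entry' {y = y} {z} {w} {l} p≈0 w≈l e = trans e (trans (+-cong (*-congˡ p≈0) (*-congˡ w≈l))
      (solve 3 (λ y z l → y :* :0 :+ z :* l := l :* z) refl y z l))

  -- Every quadratic expression comes from a core.

  linear-∣ : ∀ v a b {s₀ s₁ s₂} → v * b ≈ s₀ → v * a + b ≈ s₁ → a ≈ s₂ →
             quad v 1# 0# ∣P quad s₀ s₁ s₂
  linear-∣ v a b e₀ e₁ e₂ = quad b a 0# , at (K[x].trans (quad-* v 1# 0# b a 0#)
    (∷-cong e₀ (∷-cong (trans (+-congˡ (*-identityˡ b)) e₁)
    (∷-cong (trans (solve 3 (λ v a b → v :* :0 :+ :1 :* a :+ :0 :* b := a) refl v a b) e₂)
    (K[x].trans (∷-cong (solve 1 (λ a → :1 :* :0 :+ :0 :* a := :0) refl a)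
      (∷-cong (zeroˡ 0#) K[x].refl)) (K[x].trans (∷-cong refl X·0) X·0))))))

  scalar-∣ : ∀ {p r} z → z ·P p ≋ r → p ∣P r
  scalar-∣ {p} z e = ⟪ z ⟫ , at (K[x].trans (*P-comm p ⟪ z ⟫) (K[x].trans (⟪⟫-* z p) e))

  -- Gaussian elimination on the coefficient matrix of s and t, with the minors deciding where the
  -- pivots are. Coprimality excludes D = 0 and rank one.
  coprime⇒frac : ∀ s₀ s₁ s₂ t₀ t₁ t₂ →
    let s = quad s₀ s₁ s₂ ; t = quad t₀ t₁ t₂ in
    Coprime s t → ¬ s₂ ≈ 0# ⊎ ¬ t₂ ≈ 0# →
    ∃ λ M → ∃ λ B → s ≋ fracNum M B × t ≋ fracDen M B
  coprime⇒frac s₀ s₁ s₂ t₀ t₁ t₂ coprime s₂≉0⊎t₂≉0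
    with (s₂ * t₁ - s₁ * t₂) ≟ 0# | (s₂ * t₀ - s₀ * t₂) ≟ 0#
  -- Pivots x² and x: s = s₂ (x² + E) + s₁ (x + v), and likewise for t. Comparing constant terms
  -- gives a linear system for E and v, solved by Cramer's rule, and D = E + v².
  ... | no w₂≉0 | _ = mob s₂ s₁ t₂ t₁ w₂≉0 , inj₂ (v , D , D≉0) ,
    quad-cong (sym (trans (+-congʳ (*-congˡ D-vv≈E)) s₀≈)) (add-0 s₂ s₁) (sym (drop-0 s₂ s₁)) ,
    quad-cong (sym (trans (+-congʳ (*-congˡ D-vv≈E)) t₀≈)) (add-0 t₂ t₁) (sym (drop-0 t₂ t₁))
    where
    w₂ = s₂ * t₁ - s₁ * t₂
    E,w₂E≈ = divide (s₀ * t₁ - s₁ * t₀) w₂≉0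
    v,w₂v≈ = divide (s₂ * t₀ - s₀ * t₂) w₂≉0
    E = proj₁ E,w₂E≈
    v = proj₁ v,w₂v≈
    D = E + v * v
    D-vv≈E : D - v * v ≈ E
    D-vv≈E = solve 2 (λ E v → E :+ v :* v :- v :* v := E) refl E v
    add-0 : ∀ x y → y ≈ x * 0# + y * 1#
    add-0 = solve 2 (λ x y → y := x :* :0 :+ y :* :1) refl
    cramer : ∀ x y → w₂ * (x * E + y * v) ≈ x * (s₀ * t₁ - s₁ * t₀) + y * (s₂ * t₀ - s₀ * t₂)
    cramer x y = trans
      (solve 5 (λ w x y E v → w :* (x :* E :+ y :* v) := x :* (w :* E) :+ y :* (w :* v)) refl w₂ x y E v)
      (+-cong (*-congˡ (proj₂ E,w₂E≈)) (*-congˡ (proj₂ v,w₂v≈)))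
    s₀≈ : s₂ * E + s₁ * v ≈ s₀
    s₀≈ = *-cancelˡ w₂≉0 (trans (cramer s₂ s₁) (solve 6 (λ s₀ s₁ s₂ t₀ t₁ t₂ →
      s₂ :* (s₀ :* t₁ :- s₁ :* t₀) :+ s₁ :* (s₂ :* t₀ :- s₀ :* t₂) := (s₂ :* t₁ :- s₁ :* t₂) :* s₀)
      refl s₀ s₁ s₂ t₀ t₁ t₂))
    t₀≈ : t₂ * E + t₁ * v ≈ t₀
    t₀≈ = *-cancelˡ w₂≉0 (trans (cramer t₂ t₁) (solve 6 (λ s₀ s₁ s₂ t₀ t₁ t₂ →
      t₂ :* (s₀ :* t₁ :- s₁ :* t₀) :+ t₁ :* (s₂ :* t₀ :- s₀ :* t₂) := (s₂ :* t₁ :- s₁ :* t₂) :* t₀)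
      refl s₀ s₁ s₂ t₀ t₁ t₂))
    -- If D = 0, then x² + E = (x - v)(x + v), so x + v divides s and t; `coprime` would make its x
    -- coefficient 1 vanish.
    D≉0 : ¬ D ≈ 0#
    D≉0 D≈0 = 1≉0 (coprime (quad v 1# 0#) (x+v∣ s₀≈) (x+v∣ t₀≈) 0)
      where
      x+v∣ : ∀ {x y z} → x * E + y * v ≈ z → quad v 1# 0# ∣P quad z y x
      x+v∣ {x} {y} {z} e = linear-∣ v x (y - v * x)
        (by (+-cong e (*-congˡ { - x} D≈0)) (solve 5 (λ x y z v E →
          v :* (y :- v :* x) :- z := x :* E :+ y :* v :+ :- x :* (E :+ v :* v) :- (z :+ :- x :* :0)) refl x y z v E))
        (solve 3 (λ x y v → v :* x :+ (y :- v :* x) := y) refl x y v)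
        refl
  -- Pivots x² and 1: s = s₂ (x² + u x) + s₀, and likewise for t; w₂ = 0 makes the two equations for
  -- u compatible.
  ... | yes w₂≈0 | no w₁≉0 = mob s₂ s₀ t₂ t₀ w₁≉0 , inj₁ u ,
    quad-cong (add-0 s₂ s₀) (scaled s₁≈ s₀) (sym (drop-0 s₂ s₀)) ,
    quad-cong (add-0 t₂ t₀) (scaled t₁≈ t₀) (sym (drop-0 t₂ t₀))
    where
    w₁ = s₂ * t₀ - s₀ * t₂
    u,w₁u≈ = divide (s₁ * t₀ - s₀ * t₁) w₁≉0
    u = proj₁ u,w₁u≈
    add-0 : ∀ x y → y ≈ x * 0# + y * 1#
    add-0 = solve 2 (λ x y → y := x :* :0 :+ y :* :1) refl
    scaled : ∀ {x y} → x * u ≈ y → ∀ z → y ≈ x * u + z * 0#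
    scaled e z = sym (trans (+-congˡ (zeroʳ z)) (trans (+-identityʳ _) e))
    s₁≈ : s₂ * u ≈ s₁
    s₁≈ = *-cancelˡ w₁≉0 (by (+-cong (*-congˡ {s₂} (proj₂ u,w₁u≈)) (*-congˡ { - s₀} w₂≈0))
      (solve 7 (λ s₀ s₁ s₂ t₀ t₁ t₂ u → let w₁ = s₂ :* t₀ :- s₀ :* t₂ in
        w₁ :* (s₂ :* u) :- w₁ :* s₁ := s₂ :* (w₁ :* u) :+ :- s₀ :* (s₂ :* t₁ :- s₁ :* t₂)
          :- (s₂ :* (s₁ :* t₀ :- s₀ :* t₁) :+ :- s₀ :* :0)) refl s₀ s₁ s₂ t₀ t₁ t₂ u))
    t₁≈ : t₂ * u ≈ t₁
    t₁≈ = *-cancelˡ w₁≉0 (by (+-cong (*-congˡ {t₂} (proj₂ u,w₁u≈)) (*-congˡ { - t₀} w₂≈0))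
      (solve 7 (λ s₀ s₁ s₂ t₀ t₁ t₂ u → let w₁ = s₂ :* t₀ :- s₀ :* t₂ in
        w₁ :* (t₂ :* u) :- w₁ :* t₁ := t₂ :* (w₁ :* u) :+ :- t₀ :* (s₂ :* t₁ :- s₁ :* t₂)
          :- (t₂ :* (s₁ :* t₀ :- s₀ :* t₁) :+ :- t₀ :* :0)) refl s₀ s₁ s₂ t₀ t₁ t₂ u))
  -- Now s and t are proportional, and the one with nonzero x² coefficient is a nonconstant common
  -- divisor.
  ... | yes w₂≈0 | yes w₁≈0 = contradiction s₂≉0⊎t₂≉0 λ where
      (inj₁ s₂≉0) → let z , s₂z≈t₂ = divide t₂ s₂≉0 in
        s₂≉0 (coprime s (scalar-∣ 1# (1·P s))
          (scalar-∣ z (quad-cong (ratio s₂≉0 s₂z≈t₂ (minor≈ w₁≈0)) (ratio s₂≉0 s₂z≈t₂ (minor≈ w₂≈0)) (ratio s₂≉0 s₂z≈t₂ (*-comm t₂ s₂)))) 1)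
      (inj₂ t₂≉0) → let z , t₂z≈s₂ = divide s₂ t₂≉0 in
        t₂≉0 (coprime t (scalar-∣ z (quad-cong
            (ratio t₂≉0 t₂z≈s₂ (minor≈′ w₁≈0)) (ratio t₂≉0 t₂z≈s₂ (minor≈′ w₂≈0)) (ratio t₂≉0 t₂z≈s₂ (*-comm s₂ t₂))))
          (scalar-∣ 1# (1·P t)) 1)
    where
    s = quad s₀ s₁ s₂
    t = quad t₀ t₁ t₂
    ratio : ∀ {x y z p r} → ¬ x ≈ 0# → x * z ≈ y → y * p ≈ x * r → z * p ≈ r
    ratio {x} {y} {z} {p} {r} x≉0 xz≈y e = *-cancelˡ x≉0 (trans (sym (*-assoc x z p)) (trans (*-congʳ xz≈y) e))
    minor≈ : ∀ {x y} → s₂ * y - x * t₂ ≈ 0# → t₂ * x ≈ s₂ * y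
    minor≈ {x} {y} e = trans (*-comm t₂ x) (sym (x∙y⁻¹≈ε⇒x≈y _ _ e))
    minor≈′ : ∀ {x y} → s₂ * y - x * t₂ ≈ 0# → s₂ * y ≈ t₂ * x
    minor≈′ e = sym (minor≈ e)

  ·P-lin : ∀ μ a p b r → lin (μ * a) p (μ * b) r ≋ μ ·P lin a p b r
  ·P-lin μ a p b r = K[x].trans (+P-cong (·P-assoc μ a p) (·P-assoc μ b r)) (K[x].sym (·P-distribˡ μ (a ·P p) (b ·P r)))

  ⟪⟫≉0 : ∀ {a} → ¬ a ≈ 0# → ¬ ⟪ a ⟫ ≋ []
  ⟪⟫≉0 a≉0 e = a≉0 (at e 0)

  -- R may be unreduced, so the core is found for its reduced form S. Both parts of S are μ times
  -- those of the normalised expression, and μ cancels in the cross-multiplied equation.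
  quadratic⇒frac : ∀ R → IsQuadratic R → ∃ λ N → ∃ λ B → R ≈R frac (toMobius N) B
  quadratic⇒frac R@(r₁ / r₂ [ _ ]) (S@(s₁ / s₂ [ _ ]) , S≈R , coprime , s₁≤2 , s₂≤2 , lead) =
    let M , B , s≋ , t≋ = coprime⇒frac (coeff s₁ 0) (coeff s₁ 1) (coeff s₁ 2) (coeff s₂ 0) (coeff s₂ 1) (coeff s₂ 2)
          (λ { d (e , de≈) (f , df≈) → coprime d
            (e , at (K[x].trans (coeffwise {d *P e} de≈) (K[x].sym (degLe-2⇒quad s₁ s₁≤2))))
            (f , at (K[x].trans (coeffwise {d *P f} df≈) (K[x].sym (degLe-2⇒quad s₂ s₂≤2)))) }) lead
        N , μ , μ≉0 , a≈ , b≈ , c≈ , d≈ = normalise M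
        G = coreNum B
        H = coreDen B
        F₁ = fracNum (toMobius N) B
        F₂ = fracDen (toMobius N) B
        s₁≋ : s₁ ≋ ⟪ μ ⟫ *P F₁
        s₁≋ = K[x].trans (degLe-2⇒quad s₁ s₁≤2) (K[x].trans s≋ (K[x].trans (lin-cong G H a≈ b≈)
                (K[x].trans (·P-lin μ _ G _ H) (K[x].sym (⟪⟫-* μ F₁)))))
        s₂≋ : s₂ ≋ ⟪ μ ⟫ *P F₂
        s₂≋ = K[x].trans (degLe-2⇒quad s₂ s₂≤2) (K[x].trans t≋ (K[x].trans (lin-cong G H c≈ d≈)
                (K[x].trans (·P-lin μ _ G _ H) (K[x].sym (⟪⟫-* μ F₂)))))
    in N , B , at (*P-cancelˡ ⟪ μ ⟫ (r₁ *P F₂) (F₁ *P r₂) (⟪⟫≉0 μ≉0) (begin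
      ⟪ μ ⟫ *P (r₁ *P F₂)   ≈⟨ S.solve 3 (λ m r f → m S.:* (r S.:* f) S.:= r S.:* (m S.:* f)) K[x].refl ⟪ μ ⟫ r₁ F₂ ⟩
      r₁ *P (⟪ μ ⟫ *P F₂)   ≈⟨ *P-congˡ r₁ s₂≋ ⟨
      r₁ *P s₂              ≈⟨ coeffwise S≈R ⟨
      s₁ *P r₂              ≈⟨ *P-cong s₁≋ (K[x].refl {r₂}) ⟩
      (⟪ μ ⟫ *P F₁) *P r₂   ≈⟨ *P-assoc ⟪ μ ⟫ F₁ r₂ ⟩
      ⟪ μ ⟫ *P (F₁ *P r₂)   ∎))
    where open SetoidReasoning ≋-setoid

  -- Equivalence in terms of cores.

  infixl 7 _∘ᴹ_
  _∘ᴹ_ : Mobius → Mobius → Mobius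
  A@(mob a b c d _) ∘ᴹ B@(mob a' b' c' d' _) =
    mob (a * a' + b * c') (a * b' + b * d') (c * a' + d * c') (c * b' + d * d')
      λ e → *-≉0 (det≠0 A) (det≠0 B) (trans (solve 8 (λ a b c d a' b' c' d' →
        (a :* d :- b :* c) :* (a' :* d' :- b' :* c')
        := (a :* a' :+ b :* c') :* (c :* b' :+ d :* d') :- (a :* b' :+ b :* d') :* (c :* a' :+ d :* c'))
        refl a b c d a' b' c' d') e)

  adjugate : Mobius → Mobius
  adjugate M@(mob a b c d _) = mob d (- b) (- c) a λ e → det≠0 M
    (trans (solve 4 (λ a b c d → a :* d :- b :* c := d :* a :- :- b :* :- c) refl a b c d) e)

  lin-∘ : ∀ x y M B →
    lin x (fracNum M B) y (fracDen M B) ≋ lin (x * ma M + y * mc M) (coreNum B) (x * mb M + y * md M) (coreDen B)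
  lin-∘ x y (mob a b c d _) B = quad-cong (assoc (coreNum₀ B) (coreDen₀ B)) (assoc (coreNum₁ B) (coreDen₁ B)) (assoc 1# 0#)
    where
    assoc : ∀ g h → x * (a * g + b * h) + y * (c * g + d * h) ≈ (x * a + y * c) * g + (x * b + y * d) * h
    assoc = solve 8 (λ x y a b c d g h →
      x :* (a :* g :+ b :* h) :+ y :* (c :* g :+ d :* h) := (x :* a :+ y :* c) :* g :+ (x :* b :+ y :* d) :* h)
      refl x y a b c d

  adjugate-∘ : ∀ x y M B → let N = adjugate M in
    lin (x * ma N + y * mc N) (fracNum M B) (x * mb N + y * md N) (fracDen M B)
      ≋ det M ·P lin x (coreNum B) y (coreDen B)
  adjugate-∘ x y (mob a b c d _) B =
    quad-cong (cancel (coreNum₀ B) (coreDen₀ B)) (cancel (coreNum₁ B) (coreDen₁ B)) (cancel 1# 0#)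
    where
    cancel : ∀ g h → (x * d + y * - c) * (a * g + b * h) + (x * - b + y * a) * (c * g + d * h)
                       ≈ (a * d - b * c) * (x * g + y * h)
    cancel = solve 8 (λ x y a b c d g h →
      (x :* d :+ y :* :- c) :* (a :* g :+ b :* h) :+ (x :* :- b :+ y :* a) :* (c :* g :+ d :* h)
      := (a :* d :- b :* c) :* (x :* g :+ y :* h)) refl x y a b c d

  -- If S ∘ A = C ∘ core, then S ∘ A = (C ∘ M⁻¹) ∘ (M ∘ core), with the adjugate in place of M⁻¹.
  -- The polynomial L absorbs the surplus factor produced by homogenisation.
  frac-equivalent : ∀ M B S A C L →
    proj₁ (S ∘M A) ≋ (L *P fracNum C B) → proj₂ (S ∘M A) ≋ (L *P fracDen C B) →
    Equivalent (frac M B) S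
  frac-equivalent M B S A C L e₁ e₂ = A , C ∘ᴹ adjugate M , at (begin
    proj₁ (S ∘M A) *P den∘ (C ∘ᴹ adjugate M) (fracNum M B) (fracDen M B)
      ≈⟨ *P-cong e₁ (K[x].trans (adjugate-∘ (mc C) (md C) M B) (K[x].sym (⟪⟫-* δ _))) ⟩
    (L *P fracNum C B) *P (⟪ δ ⟫ *P fracDen C B)
      ≈⟨ S.solve 4 (λ l p δ r → l S.:* p S.:* (δ S.:* r) S.:= δ S.:* p S.:* (l S.:* r))
           K[x].refl L (fracNum C B) ⟪ δ ⟫ (fracDen C B) ⟩
    (⟪ δ ⟫ *P fracNum C B) *P (L *P fracDen C B)
      ≈⟨ *P-cong (K[x].trans (adjugate-∘ (ma C) (mb C) M B) (K[x].sym (⟪⟫-* δ _))) e₂ ⟨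
    num∘ (C ∘ᴹ adjugate M) (fracNum M B) (fracDen M B) *P proj₂ (S ∘M A) ∎)
    where
    open SetoidReasoning ≋-setoid
    δ = det M

  -- The goal multiplied by r₂ is f₂ times the last hypothesis plus a y - c x times the equation r₁
  -- f₂ = f₁ r₂; then r₂ ≠ 0 is cancelled.
  ∘-resp-≈R : ∀ C r₁ r₂ f₁ f₂ x y → ¬ r₂ ≋ [] → (r₁ *P f₂) ≋ (f₁ *P r₂) →
    (x *P den∘ C r₁ r₂) ≋ (num∘ C r₁ r₂ *P y) → (x *P den∘ C f₁ f₂) ≋ (num∘ C f₁ f₂ *P y)
  ∘-resp-≈R (mob a b c d _) r₁ r₂ f₁ f₂ x y r₂≉0 r≈f e =
    K[x].trans (*P-congˡ x (lin≋ c f₁ d f₂)) (K[x].trans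
      (*P-cancelˡ r₂ _ _ r₂≉0 (S.by (+P-cong (*P-congˡ f₂ e') (*P-congˡ k r≈f))
        (S.solve 10 (λ a b c d r₁ r₂ f₁ f₂ x y →
          let k = a S.:* y S.:- x S.:* c in
          r₂ S.:* (x S.:* (c S.:* f₁ S.:+ d S.:* f₂)) S.:- r₂ S.:* ((a S.:* f₁ S.:+ b S.:* f₂) S.:* y)
          S.:= f₂ S.:* (x S.:* (c S.:* r₁ S.:+ d S.:* r₂)) S.:+ k S.:* (r₁ S.:* f₂)
            S.:- (f₂ S.:* ((a S.:* r₁ S.:+ b S.:* r₂) S.:* y) S.:+ k S.:* (f₁ S.:* r₂)))
          K[x].refl ⟪ a ⟫ ⟪ b ⟫ ⟪ c ⟫ ⟪ d ⟫ r₁ r₂ f₁ f₂ x y)))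
      (*P-cong (K[x].sym (lin≋ a f₁ b f₂)) (K[x].refl {y})))
    where
    k = (⟪ a ⟫ *P y) +P (-P (x *P ⟪ c ⟫))
    e' : (x *P ((⟪ c ⟫ *P r₁) +P (⟪ d ⟫ *P r₂))) ≋ (((⟪ a ⟫ *P r₁) +P (⟪ b ⟫ *P r₂)) *P y)
    e' = K[x].trans (*P-congˡ x (K[x].sym (lin≋ c r₁ d r₂)))
           (K[x].trans e (*P-cong (lin≋ a r₁ b r₂) (K[x].refl {y})))

  -- Here x/y stands for S ∘ A, with reduced parts s and t. As C ∘ R = (C ∘ M) ∘ core,
  -- `disc-transfer` applies to C ∘ M, and m is its determinant.
  equivalent⇒disc : ∀ R M B C L x y {s₀ s₁ s₂ t₀ t₁ t₂} → ¬ L ≋ [] →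
    x ≋ (L *P quad s₀ s₁ s₂) → y ≋ (L *P quad t₀ t₁ t₂) →
    R ≈R frac M B → (x , y) ≈F (C M∘ R) →
    ∃ λ l → ∃ λ m → ¬ m ≈ 0# × l * l * (l * l) * disc B ≈ m * m * wronskianDisc s₀ s₁ s₂ t₀ t₁ t₂
  equivalent⇒disc R M B C L x y {s₀} {s₁} {s₂} {t₀} {t₁} {t₂} L≉0 ex ey R≈ e =
    let l , eq = disc-transfer (C ∘ᴹ M) B {s₀} {s₁} {s₂} {t₀} {t₁} {t₂}
          (K[x].trans (*P-congˡ s (K[x].sym (lin-∘ (mc C) (md C) M B)))
            (K[x].trans cancelled (*P-cong (lin-∘ (ma C) (mb C) M B) (K[x].refl {t}))))
    in l , det (C ∘ᴹ M) , det≠0 (C ∘ᴹ M) , eq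
    where
    open SetoidReasoning ≋-setoid
    s = quad s₀ s₁ s₂
    t = quad t₀ t₁ t₂
    P = num∘ C (fracNum M B) (fracDen M B)
    Q = den∘ C (fracNum M B) (fracDen M B)
    cancelled : (s *P Q) ≋ (P *P t)
    cancelled = *P-cancelˡ L (s *P Q) (P *P t) L≉0 (begin
      L *P (s *P Q)   ≈⟨ *P-assoc L s Q ⟨
      (L *P s) *P Q   ≈⟨ *P-cong ex (K[x].refl {Q}) ⟨
      x *P Q          ≈⟨ ∘-resp-≈R C (num R) (den R) (fracNum M B) (fracDen M B) x y
                           (nonZeroP⇒≉0 (den≠0 R)) (coeffwise R≈) (coeffwise e) ⟩
      P *P y          ≈⟨ *P-congˡ P ey ⟩
      P *P (L *P t)   ≈⟨ S.solve 3 (λ p l t → p S.:* (l S.:* t) S.:= l S.:* (p S.:* t)) K[x].refl P L t ⟩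
      L *P (P *P t)   ∎)

-- The two model expressions and their square classes.

module SquareClasses {κ ℓ} (K : CommutativeRing κ ℓ) (isField : IsField K)
                     (_≟_ : Decidable (CommutativeRing._≈_ K)) (2≉0 : OddCharacteristic K) where
  open QuadraticExpressions K isField _≟_ public

  linearNum linearDen : Mobius → Poly
  linearNum A = mb A ∷ ma A ∷ []
  linearDen A = md A ∷ mc A ∷ []

  linearDen≉0 : ∀ A → ¬ linearDen A ≋ []
  linearDen≉0 A e = det≠0 A (det-row₂≈0 A (at e 1) (at e 0))

  linear-* : ∀ a b a' b' → ((b ∷ a ∷ []) *P (b' ∷ a' ∷ [])) ≋ quad (b * b') (b * a' + a * b') (a * a')
  linear-* a b a' b' = quad-cong (+-identityʳ _) (+-congˡ (+-identityʳ _)) refl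

  -- `∘M` homogenises with the list length 3 and not with the degree 2, which leaves one extra
  -- factor c x + d in numerator and denominator. The same happens for the other model.
  x²∘ : (A : Mobius) → let (mob a b c d _) = A in
    proj₁ (xSquared 1≉0 ∘M A) ≋ (linearDen A *P quad (b * b) (b * a + a * b) (a * a)) ×
    proj₂ (xSquared 1≉0 ∘M A) ≋ (linearDen A *P quad (d * d) (d * c + c * d) (c * c))
  x²∘ A@(mob a b c d _) = numerator , denominator
    where
    open SetoidReasoning ≋-setoid
    L₁ = linearNum A
    L₂ = linearDen A
    numerator : proj₁ (xSquared 1≉0 ∘M A) ≋ (L₂ *P quad (b * b) (b * a + a * b) (a * a))
    numerator = begin
      (0# ·P (L₂ ^P 3)) +P (L₁ *P ((0# ·P (L₂ ^P 2)) +P (L₁ *P ((1# ·P (L₂ ^P 1)) +P (L₁ *P [])))))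
        ≈⟨ +P-cong (0·P (L₂ ^P 3)) (*P-congˡ L₁ (+P-cong (0·P (L₂ ^P 2)) (*P-congˡ L₁ (+P-cong (1·P (L₂ ^P 1)) (*P-zeroʳ L₁))))) ⟩
      L₁ *P (L₁ *P ((L₂ *P ⟪ 1# ⟫) +P []))
        ≈⟨ S.solve 2 (λ x y → x S.:* (x S.:* (y S.:* S.:1 S.:+ S.:0)) S.:= y S.:* (x S.:* x)) K[x].refl L₁ L₂ ⟩
      L₂ *P (L₁ *P L₁)
        ≈⟨ *P-congˡ L₂ (linear-* a b a b) ⟩
      L₂ *P quad (b * b) (b * a + a * b) (a * a) ∎
    denominator : proj₂ (xSquared 1≉0 ∘M A) ≋ (L₂ *P quad (d * d) (d * c + c * d) (c * c))
    denominator = begin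
      (1# ·P (L₂ ^P 3)) +P (L₁ *P [])
        ≈⟨ +P-cong (1·P (L₂ ^P 3)) (*P-zeroʳ L₁) ⟩
      (L₂ *P (L₂ *P (L₂ *P ⟪ 1# ⟫))) +P []
        ≈⟨ S.solve 1 (λ y → y S.:* (y S.:* (y S.:* S.:1)) S.:+ S.:0 S.:= y S.:* (y S.:* y)) K[x].refl L₂ ⟩
      L₂ *P (L₂ *P L₂)
        ≈⟨ *P-congˡ L₂ (linear-* c d c d) ⟩
      L₂ *P quad (d * d) (d * c + c * d) (c * c) ∎

  x²+σ/2x∘ : (σ : Carrier) (A : Mobius) → let (mob a b c d _) = A ; 2# = 1# + 1# in
    proj₁ (xSqPlusσOver2x σ 2≉0 ∘M A)
      ≋ (linearDen A *P quad (σ * (d * d) + b * b) (σ * (d * c + c * d) + (b * a + a * b)) (σ * (c * c) + a * a)) ×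
    proj₂ (xSqPlusσOver2x σ 2≉0 ∘M A)
      ≋ (linearDen A *P quad (2# * (b * d)) (2# * (b * c + a * d)) (2# * (a * c)))
  x²+σ/2x∘ σ A@(mob a b c d _) = numerator , denominator
    where
    open SetoidReasoning ≋-setoid
    L₁ = linearNum A
    L₂ = linearDen A
    2# = 1# + 1#
    numerator : proj₁ (xSqPlusσOver2x σ 2≉0 ∘M A)
      ≋ (L₂ *P quad (σ * (d * d) + b * b) (σ * (d * c + c * d) + (b * a + a * b)) (σ * (c * c) + a * a))
    numerator = begin
      (σ ·P (L₂ ^P 3)) +P (L₁ *P ((0# ·P (L₂ ^P 2)) +P (L₁ *P ((1# ·P (L₂ ^P 1)) +P (L₁ *P [])))))
        ≈⟨ +P-cong (K[x].sym (⟪⟫-* σ (L₂ ^P 3))) (*P-congˡ L₁ (+P-cong (0·P (L₂ ^P 2)) (*P-congˡ L₁ (+P-cong (1·P (L₂ ^P 1)) (*P-zeroʳ L₁))))) ⟩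
      (⟪ σ ⟫ *P (L₂ *P (L₂ *P (L₂ *P ⟪ 1# ⟫)))) +P (L₁ *P (L₁ *P ((L₂ *P ⟪ 1# ⟫) +P [])))
        ≈⟨ S.solve 3 (λ s x y → s S.:* (y S.:* (y S.:* (y S.:* S.:1))) S.:+ x S.:* (x S.:* (y S.:* S.:1 S.:+ S.:0))
             S.:= y S.:* (s S.:* (y S.:* y) S.:+ x S.:* x)) K[x].refl ⟪ σ ⟫ L₁ L₂ ⟩
      L₂ *P ((⟪ σ ⟫ *P (L₂ *P L₂)) +P (L₁ *P L₁))
        ≈⟨ *P-congˡ L₂ (+P-cong (K[x].trans (⟪⟫-* σ _) (·P-cong refl (linear-* c d c d))) (linear-* a b a b)) ⟩
      L₂ *P quad (σ * (d * d) + b * b) (σ * (d * c + c * d) + (b * a + a * b)) (σ * (c * c) + a * a) ∎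
    denominator : proj₂ (xSqPlusσOver2x σ 2≉0 ∘M A) ≋ (L₂ *P quad (2# * (b * d)) (2# * (b * c + a * d)) (2# * (a * c)))
    denominator = begin
      (0# ·P (L₂ ^P 3)) +P (L₁ *P ((2# ·P (L₂ ^P 2)) +P (L₁ *P [])))
        ≈⟨ +P-cong (0·P (L₂ ^P 3)) (*P-congˡ L₁ (+P-cong (K[x].sym (⟪⟫-* 2# (L₂ ^P 2))) (*P-zeroʳ L₁))) ⟩
      L₁ *P ((⟪ 2# ⟫ *P (L₂ *P (L₂ *P ⟪ 1# ⟫))) +P [])
        ≈⟨ S.solve 3 (λ t x y → x S.:* (t S.:* (y S.:* (y S.:* S.:1)) S.:+ S.:0) S.:= y S.:* (t S.:* (x S.:* y)))
             K[x].refl ⟪ 2# ⟫ L₁ L₂ ⟩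
      L₂ *P (⟪ 2# ⟫ *P (L₁ *P L₂))
        ≈⟨ *P-congˡ L₂ (K[x].trans (⟪⟫-* 2# _) (·P-cong refl (linear-* a b c d))) ⟩
      L₂ *P quad (2# * (b * d)) (2# * (b * c + a * d)) (2# * (a * c)) ∎

  half : Carrier → Carrier
  half x = proj₁ (divide x 2≉0)

  half+half : ∀ x → half x + half x ≈ x
  half+half x = trans (solve 1 (λ y → y :+ y := (:1 :+ :1) :* y) refl (half x)) (proj₂ (divide x 2≉0))

  square-disc⇒x² : ∀ M B s → ¬ s ≈ 0# → disc B ≈ s * s → Equivalent (frac M B) (xSquared 1≉0)
  -- Completing the square with w = u/2: x² + u x + w² = (x + w)².
  square-disc⇒x² M (inj₁ u) s _ _ = frac-equivalent M (inj₁ u) (xSquared 1≉0) A C (linearDen A)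
    (K[x].trans (proj₁ (x²∘ A)) (*P-congˡ (linearDen A) (quad-cong
      (solve 2 (λ w u → w :* w := :1 :* :0 :+ w :* w :* :1) refl w u)
      (by (half+half u) (solve 2 (λ w u → w :* :1 :+ :1 :* w :- (:1 :* u :+ w :* w :* :0) := w :+ w :- u) refl w u))
      (solve 1 (λ w → :1 :* :1 := :1 :* :1 :+ w :* w :* :0) refl w))))
    (K[x].trans (proj₂ (x²∘ A)) (*P-congˡ (linearDen A) (quad-cong
      (solve 0 (:1 :* :1 := :0 :* :0 :+ :1 :* :1) refl)
      (solve 1 (λ u → :1 :* :0 :+ :0 :* :1 := :0 :* u :+ :1 :* :0) refl u)
      (solve 0 (:0 :* :0 := :0 :* :1 :+ :1 :* :0) refl))))
    where
    w = half u
    unipotent : ∀ x → ¬ 1# * 1# - x * 0# ≈ 0#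
    unipotent x e = 1≉0 (trans (solve 1 (λ x → :1 := :1 :* :1 :- x :* :0) refl x) e)
    A = mob 1# w 0# 1# (unipotent w)
    C = mob 1# (w * w) 0# 1# (unipotent (w * w))
  square-disc⇒x² M B@(inj₂ (v , D , _)) s s≉0 D≈s² = frac-equivalent M B (xSquared 1≉0) A C (linearDen A)
    (K[x].trans (proj₁ (x²∘ A)) (*P-congˡ (linearDen A) (quad-cong
      (by (sym D≈s²) (solve 3 (λ v s D → (v :- s) :* (v :- s) :- (:1 :* (D :- v :* v) :+ (v :- s :+ (v :- s)) :* v) := s :* s :- D) refl v s D))
      (solve 2 (λ v s → (v :- s) :* :1 :+ :1 :* (v :- s) := :1 :* :0 :+ (v :- s :+ (v :- s)) :* :1) refl v s)
      (solve 2 (λ v s → :1 :* :1 := :1 :* :1 :+ (v :- s :+ (v :- s)) :* :0) refl v s))))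
    (K[x].trans (proj₂ (x²∘ A)) (*P-congˡ (linearDen A) (quad-cong
      (by (sym D≈s²) (solve 3 (λ v s D → (v :+ s) :* (v :+ s) :- (:1 :* (D :- v :* v) :+ (v :+ s :+ (v :+ s)) :* v) := s :* s :- D) refl v s D))
      (solve 2 (λ v s → (v :+ s) :* :1 :+ :1 :* (v :+ s) := :1 :* :0 :+ (v :+ s :+ (v :+ s)) :* :1) refl v s)
      (solve 2 (λ v s → :1 :* :1 := :1 :* :1 :+ (v :+ s :+ (v :+ s)) :* :0) refl v s))))
    where
    -- With y = x + v, the core is y + s²/y − 2v, and ((y − s)/(y + s))² is a Möbius function of y + s²/y.
    A = mob 1# (v - s) 1# (v + s) λ e → *-≉0 2≉0 s≉0
      (trans (solve 2 (λ v s → (:1 :+ :1) :* s := :1 :* (v :+ s) :- (v :- s) :* :1) refl v s) e)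
    C = mob 1# (v - s + (v - s)) 1# (v + s + (v + s)) λ e → *-≉0 2≉0 (*-≉0 2≉0 s≉0)
      (trans (solve 2 (λ v s → (:1 :+ :1) :* ((:1 :+ :1) :* s) := :1 :* (v :+ s :+ (v :+ s)) :- (v :- s :+ (v :- s)) :* :1) refl v s) e)

  nonsquare-disc⇒x²+σ/2x : ∀ M v D (D≉0 : ¬ D ≈ 0#) σ s → ¬ s ≈ 0# → D ≈ σ * (s * s) →
    Equivalent (frac M (inj₂ (v , D , D≉0))) (xSqPlusσOver2x σ 2≉0)
  nonsquare-disc⇒x²+σ/2x M v D D≉0 σ s s≉0 D≈σs² =
    frac-equivalent M (inj₂ (v , D , D≉0)) (xSqPlusσOver2x σ 2≉0) A C (linearDen A)
    (K[x].trans (proj₁ (x²+σ/2x∘ σ A)) (*P-congˡ (linearDen A) (quad-cong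
      (by (sym D≈σs²) (solve 4 (λ v s D σ → σ :* (s :* s) :+ v :* v :- (:1 :* (D :- v :* v) :+ (v :+ v) :* v) := σ :* (s :* s) :- D) refl v s D σ))
      (solve 3 (λ v s σ → σ :* (s :* :0 :+ :0 :* s) :+ (v :* :1 :+ :1 :* v) := :1 :* :0 :+ (v :+ v) :* :1) refl v s σ)
      (solve 2 (λ v σ → σ :* (:0 :* :0) :+ :1 :* :1 := :1 :* :1 :+ (v :+ v) :* :0) refl v σ))))
    (K[x].trans (proj₂ (x²+σ/2x∘ σ A)) (*P-congˡ (linearDen A) (quad-cong
      (solve 3 (λ v s D → (:1 :+ :1) :* (v :* s) := :0 :* (D :- v :* v) :+ (:1 :+ :1) :* s :* v) refl v s D)
      (solve 2 (λ v s → (:1 :+ :1) :* (v :* :0 :+ :1 :* s) := :0 :* :0 :+ (:1 :+ :1) :* s :* :1) refl v s)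
      (solve 1 (λ s → (:1 :+ :1) :* (:1 :* :0) := :0 :* :1 :+ (:1 :+ :1) :* s :* :0) refl s))))
    where
    -- With y = x + v the core is y + σ s²/y - 2v. Evaluating the model at y/s gives (y + σ
    -- s²/y)/(2s), hence A = (x + v)/s and C = (x + 2v)/(2s).
    A = mob 1# v 0# s λ e → s≉0 (trans (solve 2 (λ v s → s := :1 :* s :- v :* :0) refl v s) e)
    C = mob 1# (v + v) 0# ((1# + 1#) * s) λ e → *-≉0 2≉0 s≉0
      (trans (solve 2 (λ v s → (:1 :+ :1) :* s := :1 :* ((:1 :+ :1) :* s) :- (v :+ v) :* :0) refl v s) e)

  -- The right-hand side is nonzero, hence so is l, and z = m/l² works.
  square-ratio : ∀ {l m k D} → ¬ k * (m * m) ≈ 0# → l * l * (l * l) * D ≈ k * (m * m) → ∃ λ z → D ≈ k * (z * z)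
  square-ratio {l} {m} {k} {D} km²≉0 e =
    let z , l²z≈m = divide m l²≉0
    in z , *-cancelˡ (*-≉0 l²≉0 l²≉0) (trans e (trans (*-congˡ (sym (*-cong l²z≈m l²z≈m)))
         (solve 3 (λ l k z → k :* (l :* l :* z :* (l :* l :* z)) := l :* l :* (l :* l) :* (k :* (z :* z))) refl l k z)))
    where
    l²≉0 : ¬ l * l ≈ 0#
    l²≉0 l²≈0 = km²≉0 (trans (sym e) (trans (*-congʳ (trans (*-congʳ l²≈0) (zeroˡ _))) (zeroˡ D)))

  -- The Wronskian of (a x + b)² and (c x + d)² is 2δ (a x + b)(c x + d), of discriminant 4δ² · δ².
  wronskianDisc-x² : ∀ a b c d → let δ = a * d - b * c in
    wronskianDisc (b * b) (b * a + a * b) (a * a) (d * d) (d * c + c * d) (c * c) ≈ δ * δ * (δ * δ)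
  wronskianDisc-x² = solve 4 (λ a b c d → let δ = a :* d :- b :* c in
    (a :* a :* (d :* d) :- b :* b :* (c :* c)) :* (a :* a :* (d :* d) :- b :* b :* (c :* c))
      :- (a :* a :* (d :* c :+ c :* d) :- (b :* a :+ a :* b) :* (c :* c))
        :* ((b :* a :+ a :* b) :* (d :* d) :- b :* b :* (d :* c :+ c :* d))
    := δ :* δ :* (δ :* δ)) refl

  -- With X = a x + b and Y = c x + d the Wronskian is 2δ (X² - σ Y²). The form X² - σ Y² has
  -- discriminant 4σ, and the substitution contributes another δ².
  wronskianDisc-x²+σ/2x : ∀ σ a b c d → let δ = a * d - b * c ; 2# = 1# + 1# in
    wronskianDisc (σ * (d * d) + b * b) (σ * (d * c + c * d) + (b * a + a * b)) (σ * (c * c) + a * a)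
                  (2# * (b * d)) (2# * (b * c + a * d)) (2# * (a * c))
      ≈ σ * (2# * (δ * δ) * (2# * (δ * δ)))
  wronskianDisc-x²+σ/2x = solve 5 (λ σ a b c d →
    let δ = a :* d :- b :* c
        :2 = :1 :+ :1
        s₀ = σ :* (d :* d) :+ b :* b
        s₁ = σ :* (d :* c :+ c :* d) :+ (b :* a :+ a :* b)
        s₂ = σ :* (c :* c) :+ a :* a
        t₀ = :2 :* (b :* d)
        t₁ = :2 :* (b :* c :+ a :* d)
        t₂ = :2 :* (a :* c)
    in (s₂ :* t₀ :- s₀ :* t₂) :* (s₂ :* t₀ :- s₀ :* t₂) :- (s₂ :* t₁ :- s₁ :* t₂) :* (s₁ :* t₀ :- s₀ :* t₁)
       := σ :* (:2 :* (δ :* δ) :* (:2 :* (δ :* δ)))) refl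

  x²⇒square-disc : ∀ R M B → R ≈R frac M B → Equivalent R (xSquared 1≉0) → ∃ λ z → disc B ≈ z * z
  x²⇒square-disc R M B R≈ (A@(mob a b c d δ≉0) , C , e) =
    let δ = a * d - b * c
        l , m , m≉0 , eq = equivalent⇒disc R M B C (linearDen A) _ _ (linearDen≉0 A) (proj₁ (x²∘ A)) (proj₂ (x²∘ A)) R≈ e
        n = m * (δ * δ)
        n≉0 = *-≉0 m≉0 (*-≉0 δ≉0 δ≉0)
        z , D≈ = square-ratio {l} {n} {1#} (*-≉0 1≉0 (*-≉0 n≉0 n≉0)) (trans eq (trans (*-congˡ (wronskianDisc-x² a b c d))
          (solve 2 (λ m δ² → m :* m :* (δ² :* δ²) := :1 :* (m :* δ² :* (m :* δ²))) refl m (δ * δ))))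
    in z , trans D≈ (*-identityˡ _)

  x²+σ/2x⇒disc : ∀ R M B {σ} → ¬ σ ≈ 0# → R ≈R frac M B → Equivalent R (xSqPlusσOver2x σ 2≉0) →
    ∃ λ z → disc B ≈ σ * (z * z)
  x²+σ/2x⇒disc R M B {σ} σ≉0 R≈ (A@(mob a b c d δ≉0) , C , e) =
    let δ = a * d - b * c
        l , m , m≉0 , eq = equivalent⇒disc R M B C (linearDen A) _ _ (linearDen≉0 A)
          (proj₁ (x²+σ/2x∘ σ A)) (proj₂ (x²+σ/2x∘ σ A)) R≈ e
        n = m * ((1# + 1#) * (δ * δ))
        n≉0 = *-≉0 m≉0 (*-≉0 2≉0 (*-≉0 δ≉0 δ≉0))
    in square-ratio {l} {n} {σ} (*-≉0 σ≉0 (*-≉0 n≉0 n≉0)) (trans eq (trans (*-congˡ (wronskianDisc-x²+σ/2x σ a b c d))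
          (solve 3 (λ m δ² σ → m :* m :* (σ :* (δ² :* δ²)) := σ :* (m :* δ² :* (m :* δ²))) refl m ((1# + 1#) * (δ * δ)) σ)))

open import Data.Nat using (_+_; _*_; _∸_; _^_; _/_)

-- Counting in a finite field of odd characteristic.

module FiniteField {κ ℓ} (K : CommutativeRing κ ℓ) {q : ℕ} (isField : IsField K) (K-q : HasCardinality K q)
                   (2≉0 : OddCharacteristic K) where
  open FiniteSetoids
  open SquareClasses K isField (decidable (CommutativeRing.setoid K) K-q) 2≉0 public
    hiding (_+_; _*_)
  private
    module K = CommutativeRing K
    _≟_ = decidable setoid K-q

  neg-involutive : ∀ x → - (- x) ≈ x
  neg-involutive = solve 1 (λ x → :- (:- x) := x) refl

  neg-≉0 : ∀ {x} → ¬ x ≈ 0# → ¬ - x ≈ 0#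
  neg-≉0 x≉0 -x≈0 = x≉0 (trans (sym (neg-involutive _)) (trans (-‿cong -x≈0) -0#≈0#))

  ≉neg : ∀ {x} → ¬ x ≈ 0# → ¬ x ≈ - x
  ≉neg {x} x≉0 e = *-≉0 2≉0 x≉0 (by e (solve 1 (λ x → (:1 :+ :1) :* x :- :0 := x :- :- x) refl x))

  rank : Carrier → ℕ
  rank = position setoid K-q

  rank-cong : ∀ {x y} → x ≈ y → rank x ≡ rank y
  rank-cong = position-cong setoid K-q

  -- Exactly one element of each pair {x , −x} with x ≠ 0, picked by enumeration order.
  Positive : Carrier → Set _
  Positive x = ¬ x ≈ 0# × rank x ℕ.< rank (- x)

  positives : Setoid _ _
  positives = subsetoid setoid {P = Positive}

  positive-resp : ∀ {x y} → x ≈ y → Positive x → Positive y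
  positive-resp x≈y (x≉0 , lt) = (λ y≈0 → x≉0 (trans x≈y y≈0)) ,
    ≡.subst₂ ℕ._<_ (rank-cong x≈y) (rank-cong (-‿cong x≈y)) lt

  positive-asym : ∀ {x} → Positive x → ¬ Positive (- x)
  positive-asym {x} (_ , lt) (_ , lt') = ℕ.<-asym lt
    (≡.subst (rank (- x) ℕ.<_) (rank-cong (neg-involutive x)) lt')

  positive-or-neg : ∀ {x} → ¬ x ≈ 0# → Positive x ⊎ Positive (- x)
  positive-or-neg {x} x≉0 with ℕ.<-cmp (rank x) (rank (- x))
  ... | tri< lt _ _ = inj₁ (x≉0 , lt)
  ... | tri≈ _ eq _ = contradiction (position-injective setoid K-q eq) (≉neg x≉0)
  ... | tri> _ _ gt = inj₂ (neg-≉0 x≉0 , ≡.subst (rank (- x) ℕ.<_) (rank-cong (sym (neg-involutive x))) gt)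

  positives-card : ∃ (Card positives)
  positives-card = card-subsetoid setoid
    (λ x → ¬? (x ≟ 0#) ×-dec (rank x ℕ.<? rank (- x)))
    positive-resp K-q

  -- This is (q - 1)/2. Taking it as the basic quantity keeps all counts polynomial, free of
  -- division and truncated subtraction.
  h : ℕ
  h = proj₁ positives-card

  ≉0-resp : ∀ {x y} → x ≈ y → ¬ x ≈ 0# → ¬ y ≈ 0#
  ≉0-resp x≈y x≉0 y≈0 = x≉0 (trans x≈y y≈0)

  -- Negation carries the positive elements bijectively onto the remaining nonzero ones; no x ≠ 0
  -- equals -x because 2 ≠ 0.
  nonZeroElements-card : Card nonZeroElements (h + h)
  nonZeroElements-card = ≡.subst (Card nonZeroElements) (≡.sym h+h≡) (proj₂ nz)
    where
    nz : ∃ (Card nonZeroElements)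
    nz = card-subsetoid setoid (λ x → ¬? (x ≟ 0#)) ≉0-resp K-q
    f : Setoid.Carrier (positives ⊎ₛ positives) → NonZeroElement
    f (inj₁ (x , x≉0 , _)) = x , x≉0
    f (inj₂ (x , x≉0 , _)) = - x , neg-≉0 x≉0
    f-cong : ∀ {x y} → Setoid._≈_ (positives ⊎ₛ positives) x y → Setoid._≈_ nonZeroElements (f x) (f y)
    f-cong (inj₁ e) = e
    f-cong (inj₂ e) = -‿cong e
    f-inj : ∀ {x y} → Setoid._≈_ nonZeroElements (f x) (f y) → Setoid._≈_ (positives ⊎ₛ positives) x y
    f-inj {inj₁ _}       {inj₁ _}       e = inj₁ e
    f-inj {inj₁ (x , p)} {inj₂ (y , r)} e = contradiction (positive-resp e p) (positive-asym r)
    f-inj {inj₂ (x , p)} {inj₁ (y , r)} e = contradiction (positive-resp (sym e) r) (positive-asym p)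
    f-inj {inj₂ (x , _)} {inj₂ (y , _)} e = inj₂
      (trans (sym (neg-involutive x)) (trans (-‿cong e) (neg-involutive y)))
    f-surj : ∀ y → ∃ λ x → Setoid._≈_ nonZeroElements (f x) y
    f-surj (y , y≉0) with positive-or-neg y≉0
    ... | inj₁ p = inj₁ (y , p) , refl
    ... | inj₂ p = inj₂ (- y , p) , neg-involutive y
    h+h≡ : h + h ≡ proj₁ nz
    h+h≡ = card-bijective (positives ⊎ₛ positives) nonZeroElements f f-cong f-inj f-surj
      (card-⊎ positives positives (proj₂ positives-card) (proj₂ positives-card)) (proj₂ nz)

  q≡1+h+h : q ≡ suc (h + h)
  q≡1+h+h = ≡.sym (card-bijective (one ⊎ₛ nonZeroElements) setoid f f-cong f-inj f-surj
    (card-⊎ one nonZeroElements (tt ∷ [] , ≡.refl , All.[] AllPairs.∷ AllPairs.[] , λ _ → here ≡.refl) nonZeroElements-card) K-q)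
    where
    one : Setoid ℓ ℓ
    one = ≡.setoid ⊤
    f : Setoid.Carrier (one ⊎ₛ nonZeroElements) → Carrier
    f (inj₁ _)       = 0#
    f (inj₂ (x , _)) = x
    f-cong : ∀ {x y} → Setoid._≈_ (one ⊎ₛ nonZeroElements) x y → f x ≈ f y
    f-cong (inj₁ _) = refl
    f-cong (inj₂ e) = e
    f-inj : ∀ {x y} → f x ≈ f y → Setoid._≈_ (one ⊎ₛ nonZeroElements) x y
    f-inj {inj₁ _}         {inj₁ _}         e = inj₁ ≡.refl
    f-inj {inj₁ _}         {inj₂ (_ , y≉0)} e = contradiction (sym e) y≉0
    f-inj {inj₂ (_ , x≉0)} {inj₁ _}         e = contradiction e x≉0
    f-inj {inj₂ _}         {inj₂ _}         e = inj₂ e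
    f-surj : ∀ y → ∃ λ x → f x ≈ y
    f-surj y with y ≟ 0#
    ... | yes y≈0 = inj₁ tt , sym y≈0
    ... | no y≉0  = inj₂ (y , y≉0) , refl

  -- From (x - y)(x + y) = 0, the alternative x = -y would make y and -y both positive. Together
  -- with `positive-root`, each nonzero square thus has exactly one positive root.
  square-injective : ∀ {x y} → Positive x → Positive y → x K.* x ≈ y K.* y → x ≈ y
  square-injective {x} {y} px py e with (x - y) ≟ 0#
  ... | yes x-y≈0 = x∙y⁻¹≈ε⇒x≈y x y x-y≈0
  ... | no x-y≉0 = contradiction (positive-resp x≈-y px) (positive-asym py)
    where
    x≈-y : x ≈ - y
    x≈-y = by (*-cancel-0 x-y≉0 (by e (solve 2 (λ x y → (x :- y) :* (x :+ y) :- :0 := x :* x :- y :* y) refl x y)))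
      (solve 2 (λ x y → x :- :- y := x :+ y :- :0) refl x y)

  positive-root : ∀ {x} → ¬ x ≈ 0# → ∃ λ (y : ∃ Positive) → proj₁ y K.* proj₁ y ≈ x K.* x
  positive-root {x} x≉0 with positive-or-neg x≉0
  ... | inj₁ p = (x , p) , refl
  ... | inj₂ p = (- x , p) , solve 1 (λ x → :- x :* :- x := x :* x) refl x

  ≈R-respʳ : ∀ {R S T} → num S ≋ num T → den S ≋ den T → R ≈R S → R ≈R T
  ≈R-respʳ {R} {S} {T} e f R≈S = at (begin
    num R *P den T   ≈⟨ *P-congˡ (num R) f ⟨
    num R *P den S   ≈⟨ coeffwise R≈S ⟩
    num S *P den R   ≈⟨ *P-cong e (K[x].refl {den R}) ⟩
    num T *P den R   ∎)
    where open SetoidReasoning ≋-setoid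

  toMobius-cong : ∀ {M N} → Setoid._≈_ normals M N → let A = toMobius M ; B = toMobius N in
    ma A ≈ ma B × mb A ≈ mb B × mc A ≈ mc B × md A ≈ md B
  toMobius-cong (inj₁ (a≈ , d≈ , δ≈)) = a≈ , +-cong (*-cong a≈ d≈) (-‿cong δ≈) , refl , d≈
  toMobius-cong (inj₂ (a≈ , b≈))      = a≈ , b≈ , refl , refl

  core-cong : ∀ {B B'} → Setoid._≈_ cores B B' → coreNum B ≋ coreNum B' × coreDen B ≋ coreDen B'
  core-cong (inj₁ u≈)        = quad-cong refl u≈ refl , K[x].refl
  core-cong (inj₂ (v≈ , D≈)) = quad-cong (+-cong D≈ (-‿cong (*-cong v≈ v≈))) refl refl , quad-cong v≈ refl refl

  frac-cong : ∀ {M N B B'} → Setoid._≈_ normals M N → Setoid._≈_ cores B B' →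
    fracNum (toMobius M) B ≋ fracNum (toMobius N) B' × fracDen (toMobius M) B ≋ fracDen (toMobius N) B'
  frac-cong {M} {N} {B} {B'} M≈N B≈B' =
    let a≈ , b≈ , c≈ , d≈ = toMobius-cong M≈N
        g≈ , h≈ = core-cong B≈B'
    in +P-cong (·P-cong a≈ g≈) (·P-cong b≈ h≈) , +P-cong (·P-cong c≈ g≈) (·P-cong d≈ h≈)

  -- With 2h = q - 1 this is q²(q - 1) + (q - 1) q = q³ - q, the order of PGL₂(K).
  normals-card : Card normals (q * (q * (h + h)) + (h + h) * q)
  normals-card = card-⊎ (setoid ×ₛ (setoid ×ₛ nonZeroElements)) (nonZeroElements ×ₛ setoid)
    (card-× setoid (setoid ×ₛ nonZeroElements) K-q (card-× setoid nonZeroElements K-q nonZeroElements-card))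
    (card-× nonZeroElements setoid nonZeroElements-card K-q)

  -- The three counts.

  module _ {a b : Level} {n : ℕ} (T : Setoid a b) (core : Setoid.Carrier T → Core) {P : RatExpr → Set (κ ⊔ ℓ)} where
    private
      module T = Setoid T
      module N×T = Setoid (normals ×ₛ T)

    -- T parametrises without repetition the cores that P admits. By `frac-injective` the pairs of a
    -- normalised matrix and an element of T give distinct expressions, and completeness only asks
    -- that some core of each R with P lies in the image of T.
    count : Card T n →
      (∀ {x y} → x T.≈ y → Setoid._≈_ cores (core x) (core y)) →
      (∀ {x y} → Setoid._≈_ cores (core x) (core y) → x T.≈ y) →
      (∀ N x → P (frac (toMobius N) (core x))) →
      (∀ R → P R → ∃ λ N → ∃ λ B → R ≈R frac (toMobius N) B × ∃ λ x → Setoid._≈_ cores B (core x)) →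
      CountIs ((q * (q * (h + h)) + (h + h) * q) * n) P
    count T-n cong inj P-frac P-core =
      let xs , length≡ , u , _ = N×T-card in
      map f xs , ≡.trans (length-map f xs) length≡ ,
      All.map⁺ (All.universal (λ x → P-frac (proj₁ x) (proj₂ x)) xs) ,
      AllPairs.map⁺ (AllPairs.map (λ x≉y e → x≉y (f-inj e)) u) ,
      complete
      where
      N×T-card : Card (normals ×ₛ T) _
      N×T-card = card-× normals T normals-card T-n
      f : N×T.Carrier → RatExpr
      f (N , x) = frac (toMobius N) (core x)
      f-inj : ∀ {x y} → f x ≈R f y → x N×T.≈ y
      f-inj {M , x} {N , y} e = let M≈N , x≈y = frac-injective M N (core x) (core y) e in M≈N , inj x≈y
      complete : ∀ R → P R → Any (R ≈R_) (map f (proj₁ N×T-card))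
      complete R P-R =
        let N , B , R≈ , x , B≈ = P-core R P-R
        in Any.map⁺ (Any.map (λ {y} y≈ →
             let e₁ , e₂ = frac-cong {N} {proj₁ y} {B} {core (proj₂ y)} (proj₁ y≈)
                             (Setoid.trans cores {B} {core x} B≈ (cong (proj₂ y≈)))
             in ≈R-respʳ {R} {frac (toMobius N) B} {f y} e₁ e₂ R≈) (proj₂ (proj₂ (proj₂ N×T-card)) (N , x)))

  count-quadratic : CountIs ((q * (q * (h + h)) + (h + h) * q) * (q + q * (h + h))) IsQuadratic
  count-quadratic = count cores (λ B → B)
    (card-⊎ setoid (setoid ×ₛ nonZeroElements) K-q (card-× setoid nonZeroElements K-q nonZeroElements-card))
    (λ e → e) (λ e → e) (λ N B → frac-isQuadratic (toMobius N) B)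
    λ R quadratic → let N , B , R≈ = quadratic⇒frac R quadratic in N , B , R≈ , B , Setoid.refl cores {B}

  count-x² : CountIs ((q * (q * (h + h)) + (h + h) * q) * (q + q * h))
    (λ R → IsQuadratic R × Equivalent R (xSquared 1≉0))
  count-x² = count (setoid ⊎ₛ (setoid ×ₛ positives)) core
    (card-⊎ setoid (setoid ×ₛ positives) K-q (card-× setoid positives K-q (proj₂ positives-card)))
    core-resp core-inj
    (λ N x → frac-isQuadratic (toMobius N) (core x) , core-equivalent N x)
    λ { R (quadratic , equivalent) →
      let N , B , R≈ = quadratic⇒frac R quadratic
          z , D≈z² = x²⇒square-disc R (toMobius N) B R≈ equivalent
      in N , B , R≈ , square-core B z D≈z² }
    where
    core : Setoid.Carrier (setoid ⊎ₛ (setoid ×ₛ positives)) → Core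
    core (inj₁ u)                 = inj₁ u
    core (inj₂ (v , s , s≉0 , _)) = inj₂ (v , s K.* s , *-≉0 s≉0 s≉0)
    core-resp : ∀ {x y} → Setoid._≈_ (setoid ⊎ₛ (setoid ×ₛ positives)) x y → Setoid._≈_ cores (core x) (core y)
    core-resp (inj₁ e)       = inj₁ e
    core-resp (inj₂ (e , f)) = inj₂ (e , *-cong f f)
    core-inj : ∀ {x y} → Setoid._≈_ cores (core x) (core y) → Setoid._≈_ (setoid ⊎ₛ (setoid ×ₛ positives)) x y
    core-inj {inj₁ _} {inj₁ _} (inj₁ e) = inj₁ e
    core-inj {inj₁ _} {inj₂ _} ()
    core-inj {inj₂ _} {inj₁ _} ()
    core-inj {inj₂ (_ , _ , p)} {inj₂ (_ , _ , r)} (inj₂ (e , f)) = inj₂ (e , square-injective p r f)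
    core-equivalent : ∀ N x → Equivalent (frac (toMobius N) (core x)) (xSquared 1≉0)
    core-equivalent N (inj₁ u) = square-disc⇒x² (toMobius N) (inj₁ u) 1# 1≉0 (sym (*-identityˡ 1#))
    core-equivalent N x@(inj₂ (v , s , s≉0 , _)) = square-disc⇒x² (toMobius N) (core x) s s≉0 refl
    square-core : ∀ B z → disc B ≈ z K.* z → ∃ λ x → Setoid._≈_ cores B (core x)
    square-core (inj₁ u) z e = inj₁ u , inj₁ refl
    square-core (inj₂ (v , D , D≉0)) z e =
      let s , s²≈z² = positive-root {z} (λ z≈0 → D≉0 (trans e (trans (*-congʳ z≈0) (zeroˡ z))))
      in inj₂ (v , s) , inj₂ (refl , trans e (sym s²≈z²))

  module _ {σ : Carrier} (nonsquare : IsNonsquare K σ) where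
    σ≉0 : ¬ σ ≈ 0#
    σ≉0 = proj₁ nonsquare

    -- Otherwise (σ z)² = σ · σ z² = σ. This excludes the cores x² + u x from the second class.
    1≉σ*square : ∀ z → ¬ 1# ≈ σ K.* (z K.* z)
    1≉σ*square z e = proj₂ nonsquare (σ K.* z) (trans
      (solve 2 (λ σ z → σ :* z :* (σ :* z) := σ :* (σ :* (z :* z))) refl σ z)
      (trans (*-congˡ (sym e)) (*-identityʳ σ)))

    count-x²+σ/2x : CountIs ((q * (q * (h + h)) + (h + h) * q) * (q * h))
      (λ R → IsQuadratic R × Equivalent R (xSqPlusσOver2x σ 2≉0))
    count-x²+σ/2x = count (setoid ×ₛ positives) core
      (card-× setoid positives K-q (proj₂ positives-card))
      (λ { (e , f) → inj₂ (e , *-congˡ (*-cong f f)) })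
      (λ { {_ , _ , p} {_ , _ , r} (inj₂ (e , f)) → e , square-injective p r (*-cancelˡ σ≉0 f) })
      (λ { N x@(v , s , s≉0 , _) → frac-isQuadratic (toMobius N) (core x) ,
           nonsquare-disc⇒x²+σ/2x (toMobius N) v _ (*-≉0 σ≉0 (*-≉0 s≉0 s≉0)) σ s s≉0 refl })
      λ { R (quadratic , equivalent) →
        let N , B , R≈ = quadratic⇒frac R quadratic
            z , D≈σz² = x²+σ/2x⇒disc R (toMobius N) B σ≉0 R≈ equivalent
        in N , B , R≈ , nonsquare-core B z D≈σz² }
      where
      core : Setoid.Carrier (setoid ×ₛ positives) → Core
      core (v , s , s≉0 , _) = inj₂ (v , σ K.* (s K.* s) , *-≉0 σ≉0 (*-≉0 s≉0 s≉0))
      nonsquare-core : ∀ B z → disc B ≈ σ K.* (z K.* z) → ∃ λ x → Setoid._≈_ cores B (core x)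
      nonsquare-core (inj₁ u) z e = contradiction e (1≉σ*square z)
      nonsquare-core (inj₂ (v , D , D≉0)) z e =
        let s , s²≈z² = positive-root {z} (λ z≈0 → D≉0 (trans e (trans (*-congˡ (trans (*-congʳ z≈0) (zeroˡ z))) (zeroʳ σ))))
        in (v , s) , inj₂ (refl , trans e (*-congˡ (sym s²≈z²)))

-- Closed forms of the counts.

module Arithmetic (h : ℕ) where
  open +-*-Solver
  q normalsCount : ℕ
  q = suc (h + h)
  normalsCount = q * (q * (h + h)) + (h + h) * q

  -- Once q² is written as 1 + ..., the truncated subtraction computes.
  q²∸1 : q ^ 2 ∸ 1 ≡ (h + h) * (q + 1)
  q²∸1 = ≡.cong (_∸ 1) (solve 1 (λ h →
    let q = con 1 :+ (h :+ h) in q :* (q :* con 1) := con 1 :+ (h :+ h) :* (q :+ con 1)) ≡.refl h)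

  quadratic-total : normalsCount * (q + q * (h + h)) ≡ q ^ 3 * (q ^ 2 ∸ 1)
  quadratic-total = ≡.trans
    (solve 1 (λ h → let q = con 1 :+ (h :+ h) in
      (q :* (q :* (h :+ h)) :+ (h :+ h) :* q) :* (q :+ q :* (h :+ h))
      := q :* (q :* (q :* con 1)) :* ((h :+ h) :* (q :+ con 1))) ≡.refl h)
    (≡.cong (q ^ 3 *_) (≡.sym q²∸1))

  -- Division rounds down, so exactness is shown by proving twice the count equal to the numerator.
  halves : ∀ {m n} → m * 2 ≡ n → m ≡ n / 2
  halves {m} ≡.refl = ≡.sym (m*n/n≡m m 2)

  x²-total : normalsCount * (q + q * h) ≡ q ^ 2 * (q ^ 2 ∸ 1) * (q + 1) / 2
  x²-total = halves (≡.trans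
    (solve 1 (λ h → let q = con 1 :+ (h :+ h) in
      (q :* (q :* (h :+ h)) :+ (h :+ h) :* q) :* (q :+ q :* h) :* con 2
      := q :* (q :* con 1) :* ((h :+ h) :* (q :+ con 1)) :* (q :+ con 1)) ≡.refl h)
    (≡.cong (λ k → q ^ 2 * k * (q + 1)) (≡.sym q²∸1)))

  x²+σ/2x-total : normalsCount * (q * h) ≡ q ^ 2 * (q ^ 2 ∸ 1) * (q ∸ 1) / 2
  x²+σ/2x-total = halves (≡.trans
    (solve 1 (λ h → let q = con 1 :+ (h :+ h) in
      (q :* (q :* (h :+ h)) :+ (h :+ h) :* q) :* (q :* h) :* con 2
      := q :* (q :* con 1) :* ((h :+ h) :* (q :+ con 1)) :* (h :+ h)) ≡.refl h)
    (≡.cong (λ k → q ^ 2 * k * (q ∸ 1)) (≡.sym q²∸1)))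

theorem3p1 : ∀ {c ℓ} (K : CommutativeRing c ℓ) (q : ℕ)
    → (isField : IsField K) → HasCardinality K q
    → (oddChar : OddCharacteristic K)
    → (σ : CommutativeRing.Carrier K) → IsNonsquare K σ
    → let open Over K in
    CountIs (q ^ 3 * (q ^ 2 ∸ 1)) IsQuadratic
    × CountIs (q ^ 2 * (q ^ 2 ∸ 1) * (q + 1) / 2)
    (λ R → IsQuadratic R × Equivalent R (xSquared (proj₁ isField)))
    × CountIs (q ^ 2 * (q ^ 2 ∸ 1) * (q ∸ 1) / 2)
    (λ R → IsQuadratic R × Equivalent R (xSqPlusσOver2x σ oddChar))
theorem3p1 K q isField K-q oddChar σ nonsquare =
  recount (λ q → q ^ 3 * (q ^ 2 ∸ 1)) (λ q → size q * (q + q * (h + h))) quadratic-total count-quadratic ,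
  recount (λ q → q ^ 2 * (q ^ 2 ∸ 1) * (q + 1) / 2) (λ q → size q * (q + q * h)) x²-total count-x² ,
  recount (λ q → q ^ 2 * (q ^ 2 ∸ 1) * (q ∸ 1) / 2) (λ q → size q * (q * h)) x²+σ/2x-total (count-x²+σ/2x nonsquare)
  where
  open FiniteField K isField K-q oddChar using (h; q≡1+h+h; count-quadratic; count-x²; count-x²+σ/2x)
  open Arithmetic h using (quadratic-total; x²-total; x²+σ/2x-total)
  open Over K using (CountIs)
  size : ℕ → ℕ
  size q = q * (q * (h + h)) + (h + h) * q
  -- The closed forms are proved for the literal `suc (h + h)`, where q ∸ 1 reduces. Treating both
  -- sides as functions of q allows the transport to the given q along `q≡1+h+h`.
  recount : ∀ (to from : ℕ → ℕ) {P} → from (suc (h + h)) ≡ to (suc (h + h)) → CountIs (from q) P → CountIs (to q) P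
  recount to from {P} e = ≡.subst (λ n → CountIs n P)
    (≡.trans (≡.cong from q≡1+h+h) (≡.trans e (≡.cong to (≡.sym q≡1+h+h))))
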